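{- For every connected graph $G$ on $n$ vertices, $b(G)\leq (1+o(1))\sqrt{n}$, where $o(1)$ denotes a quantity depending only on $n$ that tends to $0$ as $n\to\infty$. Equivalently: for every $\varepsilon>0$ there exists $N$ such that every connected graph $G$ on $n\geq N$ vertices satisfies $b(G)\leq (1+\varepsilon)\sqrt n$.
   Context: All graphs are finite. For a graph $G$ with graph distance $d_G$, the burning number $b(G)$ is the smallest integer $k$ such that there exist vertices $x_0,x_1,\dots,x_{k-1}$ of $G$ (not necessarily distinct) with the property that every vertex $u$ of $G$ satisfies $d_G(u,x_i)\leq i$ for some $i\in\{0,\dots,k-1\}$; i.e. $V(G)$ can be covered by closed balls of radii $0,1,\dots,k-1$. (Equivalently, it is the minimum number of rounds needed to burn all of $G$ when in each round a new fire is started at one vertex and all existing fires spread to all neighbouring vertices.) -}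

module Defs where

open import Data.Nat using (ℕ; zero; suc; _*_; _+_; _≤_; _^_)
open import Data.Fin using (Fin; toℕ)
open import Data.Bool using (Bool; true; false)
open import Data.Product using (Σ; _×_; ∃)
open import Relation.Binary.PropositionalEquality using (_≡_)

record Graph (n : ℕ) : Set where
  field
    adj    : Fin n → Fin n → Bool
    sym    : ∀ u v → adj u v ≡ true → adj v u ≡ true
    irrefl : ∀ u → adj u u ≡ false

open Graph public

data Within {n : ℕ} (G : Graph n) : Fin n → Fin n → ℕ → Set where
  here : ∀ {u r} → Within G u u r
  step : ∀ {u v w r} → adj G u v ≡ true → Within G v w r → Within G u w (suc r)

Connected : {n : ℕ} → Graph n → Set
Connected {n} G = ∀ (u v : Fin n) → ∃ λ r → Within G u v r

Burns : {n : ℕ} → Graph n → ℕ → Set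
Burns {n} G k = Σ (Fin k → Fin n) λ x → ∀ (u : Fin n) → ∃ λ (i : Fin k) → Within G u (x i) (toℕ i)

-- b(G) ≤ (1 + 1/k) √n, i.e. (since b(G) = min {b | Burns G b}) some b with Burns G b
-- has b ≤ ((k+1)/k) √n, equivalently (b k)^2 ≤ (k+1)^2 n.
BurningNumberAtMostSqrt : {n : ℕ} → Graph n → (k : ℕ) → Set
BurningNumberAtMostSqrt {n} G k = ∃ λ b → Burns G b × (b * k) ^ 2 ≤ (k + 1) ^ 2 * n

{-# OPTIONS --safe #-}
module Submission where

-- In a spanning tree, give a vertex of height h a ball of radius h with weight 2 if h < R and a ball of
-- radius R with weight 1 otherwise; with an extra weight 2 R at the root every vertex is covered at least
-- 2 R times. Testing a weighting of the vertices against this fractional cover, for the R that minimises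
-- W(R) / R² where W(R) adds up the largest masses of balls of radii 1, ..., R, shows that the weighting is small
-- whenever it respects given prices of balls. Balls through a vertex x are nested on the vertices at most as
-- deep as x, so covering has no integrality gap, and a tree piece has an honest cover by balls with D
-- different radii L, 2 L, ..., D L whose price is at most about |piece| / (D² L) times the sum of the prices.
-- The spanning tree is cut into pieces of about D² L vertices, which are covered one after another at prices
-- growing linearly with the excess use of each radius. A quadratic potential shows that in the end no radius
-- is used more than L times, where n is about (D L)². Rounding radii up within blocks of length L then burns
-- the graph in (D + 1) L rounds.

open import Defs hiding (sym)
open import Data.Bool using (true)
open import Data.Empty using (⊥-elim)
open import Data.Fin using (Fin; toℕ)
import Data.Fin as Fin
import Data.Fin.Properties as Fin
open import Data.List using (List; []; _∷_; _++_; map; length; lookup; filter; downFrom; cartesianProduct; allFin)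
import Data.List.Membership.DecPropositional as DecPropositional
open import Data.List.Membership.Propositional using (_∈_; _∉_; lose; find)
open import Data.List.Membership.Propositional.Properties
open import Data.List.Properties using (length-++; length-map; length-downFrom)
open import Data.List.Relation.Binary.Permutation.Propositional using (↭-sym)
open import Data.List.Relation.Binary.Permutation.Propositional.Properties using (∈-resp-↭)
open import Data.List.Relation.Unary.All using (All; []; _∷_)
import Data.List.Relation.Unary.All as All
import Data.List.Relation.Unary.All.Properties as All
open import Data.List.Relation.Unary.AllPairs using (AllPairs; []; _∷_)
open import Data.List.Relation.Unary.Any using (here; there)
import Data.List.Relation.Unary.Any as Any
import Data.List.Relation.Unary.Any.Properties as Any
open import Data.List.Relation.Unary.Sorted.TotalOrder.Properties using (Sorted⇒AllPairs)
open import Data.List.Relation.Unary.Unique.Propositional using (Unique)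
open import Data.List.Sort using (sort; sort-↭; sort-↗)
open import Data.Nat using (ℕ; zero; suc; _+_; _*_; _∸_; _^_; _≤_; _<_; _≤?_; _<?_; _≟_; z≤n; s≤s; s≤s⁻¹; NonZero; >-nonZero; >-nonZero⁻¹; _⊔_; _⊓_)
open import Data.Nat.Properties
open import Data.Nat.Tactic.RingSolver using (solve-∀)
open import Data.Product using (∃; _×_; _,_; proj₁; proj₂)
open import Data.Sum using (_⊎_; inj₁; inj₂)
import Data.Sum as Sum
open import Data.Unit using (⊤; tt)
open import Function using (_∘_)
open import Relation.Binary using (DecTotalOrder)
import Relation.Binary.Construct.Flip.EqAndOrd as Flip
import Relation.Binary.Construct.On as On
open import Relation.Binary.PropositionalEquality using (_≡_; refl; sym; trans; cong; cong₂; subst; subst₂)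
open import Relation.Nullary using (¬_; Dec; yes; no)

-- Write w(R) for the largest mass of a ball of radius R. Comparing a minimiser R of W(R) / R² with
-- R - 1 gives w(R) ≤ 2 W(R) / R. Hence weight 1 on balls of radius R and weight 2 on smaller ones
-- obey the same bound: on average at most 2 W(R) / R per vertex. Since each vertex is hit 2 R
-- times, the total mass is at most about n W(R) / R², and minimality carries this to the largest
-- radius; this is where the leading constant 1 comes from.
--
-- Applied once to the whole tree, duality bounds only the total price of a cover, whereas burning
-- limits the use of every single radius. So prices must react to past use, and the pieces must be
-- small enough to keep the second-order terms of the potential negligible. Such prices need not be
-- monotone in the radius; the argument needs monotonicity only of the largest masses of balls,
-- which always have it.
--
-- Cutting is affordable: a piece of about D² L vertices is charged 2 D L + 1 on top of its size, a
-- fraction of order 1 / D. Only D classes of radii are used, so that the number of prices stays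
-- fixed while L grows with n.

-- Arithmetic, indicators, finite sums and maxima

-- Linear consequences: t is the slack of x ≤ y after cancelling a ≤ b.
≤-from : ∀ {a b} → a ≤ b → ∀ {x y} t → x + b + t ≡ a + y → x ≤ y
≤-from {a} {b} a≤b {x} {y} t eq = +-cancelˡ-≤ b x y (begin
  b + x      ≡⟨ +-comm b x ⟩
  x + b      ≤⟨ m≤m+n (x + b) t ⟩
  x + b + t  ≡⟨ eq ⟩
  a + y      ≤⟨ +-monoˡ-≤ y a≤b ⟩
  b + y      ∎)
  where open ≤-Reasoning

𝟙 : {P : Set} → Dec P → ℕ
𝟙 (yes _) = 1
𝟙 (no _)  = 0

𝟙-yes : {P : Set} (d : Dec P) → P → 𝟙 d ≡ 1
𝟙-yes (yes _) p = refl
𝟙-yes (no ¬p) p = ⊥-elim (¬p p)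

𝟙-no : {P : Set} (d : Dec P) → ¬ P → 𝟙 d ≡ 0
𝟙-no (yes p) ¬p = ⊥-elim (¬p p)
𝟙-no (no _)  ¬p = refl

𝟙-mono : {P Q : Set} (d : Dec P) (e : Dec Q) → (P → Q) → 𝟙 d ≤ 𝟙 e
𝟙-mono (no _)  _       f = z≤n
𝟙-mono (yes p) (yes _) f = ≤-refl
𝟙-mono (yes p) (no ¬q) f = ⊥-elim (¬q (f p))

∑ : {A : Set} → List A → (A → ℕ) → ℕ
∑ []       f = 0
∑ (x ∷ xs) f = f x + ∑ xs f

module _ {A : Set} where

  ∑-mono : (xs : List A) {f g : A → ℕ} → (∀ x → x ∈ xs → f x ≤ g x) → ∑ xs f ≤ ∑ xs g
  ∑-mono []       f≤g = z≤n
  ∑-mono (x ∷ xs) f≤g = +-mono-≤ (f≤g x (here refl)) (∑-mono xs (λ y y∈ → f≤g y (there y∈)))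

  ∑-cong : (xs : List A) {f g : A → ℕ} → (∀ x → f x ≡ g x) → ∑ xs f ≡ ∑ xs g
  ∑-cong []       f≡g = refl
  ∑-cong (x ∷ xs) f≡g = cong₂ _+_ (f≡g x) (∑-cong xs f≡g)

  ∑-++ : (xs ys : List A) (f : A → ℕ) → ∑ (xs ++ ys) f ≡ ∑ xs f + ∑ ys f
  ∑-++ []       ys f = refl
  ∑-++ (x ∷ xs) ys f = trans (cong (f x +_) (∑-++ xs ys f)) (sym (+-assoc (f x) _ _))

  ∑-map : {B : Set} (h : A → B) (xs : List A) (f : B → ℕ) → ∑ (map h xs) f ≡ ∑ xs (f ∘ h)
  ∑-map h []       f = refl
  ∑-map h (x ∷ xs) f = cong (f (h x) +_) (∑-map h xs f)

  ∑-+ : (xs : List A) (f g : A → ℕ) → ∑ xs (λ x → f x + g x) ≡ ∑ xs f + ∑ xs g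
  ∑-+ []       f g = refl
  ∑-+ (x ∷ xs) f g = trans (cong (f x + g x +_) (∑-+ xs f g)) (interchange (f x) (g x) (∑ xs f) (∑ xs g))
    where
    interchange : ∀ a b c d → a + b + (c + d) ≡ a + c + (b + d)
    interchange = solve-∀

  ∑-* : (c : ℕ) (xs : List A) (f : A → ℕ) → ∑ xs (λ x → c * f x) ≡ c * ∑ xs f
  ∑-* c []       f = sym (*-zeroʳ c)
  ∑-* c (x ∷ xs) f = trans (cong (c * f x +_) (∑-* c xs f)) (sym (*-distribˡ-+ c (f x) _))

  ∑-const : (xs : List A) (c : ℕ) → ∑ xs (λ _ → c) ≡ length xs * c
  ∑-const []       c = refl
  ∑-const (x ∷ xs) c = cong (c +_) (∑-const xs c)

  ∑-term : {xs : List A} {x : A} (f : A → ℕ) → x ∈ xs → f x ≤ ∑ xs f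
  ∑-term f (here refl) = m≤m+n _ _
  ∑-term f (there x∈)  = ≤-trans (∑-term f x∈) (m≤n+m _ _)

∑-swap : {A B : Set} (xs : List A) (ys : List B) (f : A → B → ℕ) →
         ∑ xs (λ x → ∑ ys (f x)) ≡ ∑ ys (λ y → ∑ xs (λ x → f x y))
∑-swap []       ys f = sym (trans (∑-const ys 0) (*-zeroʳ (length ys)))
∑-swap (x ∷ xs) ys f = trans (cong (∑ ys (f x) +_) (∑-swap xs ys f)) (sym (∑-+ ys (f x) _))

maximum : {A : Set} → List A → (A → ℕ) → ℕ
maximum []       f = 0
maximum (x ∷ xs) f = f x ⊔ maximum xs f

f≤maximum : {A : Set} {xs : List A} {x : A} (f : A → ℕ) → x ∈ xs → f x ≤ maximum xs f
f≤maximum f (here refl) = m≤m⊔n _ _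
f≤maximum f (there x∈)  = ≤-trans (f≤maximum f x∈) (m≤n⊔m _ _)

maximum≤ : {A : Set} (xs : List A) {f : A → ℕ} {b : ℕ} → (∀ x → f x ≤ b) → maximum xs f ≤ b
maximum≤ []       f≤b = z≤n
maximum≤ (x ∷ xs) f≤b = ⊔-lub (f≤b x) (maximum≤ xs f≤b)

maximum-mono : {A : Set} (xs : List A) {f g : A → ℕ} → (∀ x → f x ≤ g x) → maximum xs f ≤ maximum xs g
maximum-mono []       f≤g = z≤n
maximum-mono (x ∷ xs) f≤g = ⊔-mono-≤ (f≤g x) (maximum-mono xs f≤g)

-- Forests, their distances and the ultrametric of common ancestors

module _ {V : Set} {E : V → V → Set} where

  -- A forest hanging below the vertex r, as a first-child/next-sibling tree.
  data Forest (r : V) : Set where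
    ∅    : Forest r
    cons : (v : V) → E r v → Forest v → Forest r → Forest r

  data Pos : {r : V} → Forest r → Set where
    top  : ∀ {r v e} {c : Forest v} {s : Forest r} → Pos (cons v e c s)
    down : ∀ {r v e} {c : Forest v} {s : Forest r} → Pos c → Pos (cons v e c s)
    next : ∀ {r v e} {c : Forest v} {s : Forest r} → Pos s → Pos (cons v e c s)

  private variable
    r : V
    F : Forest r

  label : Pos F → V
  label (top {v = v}) = v
  label (down p)      = label p
  label (next p)      = label p

  size : Forest r → ℕ
  size ∅              = 0
  size (cons _ _ c s) = suc (size c + size s)

  levels : Forest r → ℕ
  levels ∅              = 0
  levels (cons _ _ c s) = suc (levels c) ⊔ levels s

  positions : (F : Forest r) → List (Pos F)
  positions ∅              = []
  positions (cons _ _ c s) = top ∷ map down (positions c) ++ map next (positions s)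

  ∈-positions : (p : Pos F) → p ∈ positions F
  ∈-positions top              = here refl
  ∈-positions (down p)         = there (∈-++⁺ˡ (∈-map⁺ down (∈-positions p)))
  ∈-positions (next {c = c} p) =
    there (∈-++⁺ʳ (map down (positions c)) (∈-map⁺ next (∈-positions p)))

  ∑-positions : {v : V} {e : E r v} (c : Forest v) (s : Forest r) (f : Pos (cons v e c s) → ℕ) →
    ∑ (positions (cons v e c s)) f ≡
    f top + (∑ (positions c) (λ p → f (down p)) + ∑ (positions s) (λ p → f (next p)))
  ∑-positions c s f = cong (f top +_)
    (trans (∑-++ (map down (positions c)) (map next (positions s)) f)
      (cong₂ _+_ (∑-map down (positions c) f) (∑-map next (positions s) f)))

  dep : Pos F → ℕ
  dep top      = 0
  dep (down p) = suc (dep p)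
  dep (next p) = dep p

  height : Pos F → ℕ
  height (top {c = c}) = levels c
  height (down p)      = height p
  height (next p)      = height p

  dep<levels : (p : Pos F) → dep p < levels F
  dep<levels (top {s = s})            = m≤n⇒m≤n⊔o (levels s) (s≤s z≤n)
  dep<levels (down {s = s} p)         = m≤n⇒m≤n⊔o (levels s) (s≤s (dep<levels p))
  dep<levels (next {c = c} {s = s} p) = m≤n⇒m≤o⊔n (suc (levels c)) (dep<levels p)

  -- The roots of a forest count as children of a common vertex.
  dist : Pos F → Pos F → ℕ
  dist top      top      = 0
  dist top      (down q) = 1 + dep q
  dist top      (next q) = 2 + dep q
  dist (down p) top      = 1 + dep p
  dist (down p) (down q) = dist p q
  dist (down p) (next q) = 3 + (dep q + dep p)
  dist (next p) top      = 2 + dep p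
  dist (next p) (down q) = 3 + (dep q + dep p)
  dist (next p) (next q) = dist p q

  -- The number of common ancestors, every position being an ancestor of itself; it is one more than
  -- the depth of the lowest one.
  meet : Pos F → Pos F → ℕ
  meet top      top      = 1
  meet top      (down q) = 1
  meet top      (next q) = 0
  meet (down p) top      = 1
  meet (down p) (down q) = suc (meet p q)
  meet (down p) (next q) = 0
  meet (next p) top      = 0
  meet (next p) (down q) = 0
  meet (next p) (next q) = meet p q

  -- The path climbs from both ends to the lowest common ancestor. For two different trees this is
  -- the virtual common vertex, at depth -1.
  dist+2meet : (p q : Pos F) → dist p q + 2 * meet p q ≡ 2 + (dep p + dep q)
  dist+2meet top      top      = refl
  dist+2meet top      (down q) = lem (dep q)
    where
    lem : ∀ d → 1 + d + 2 * 1 ≡ 2 + (0 + (1 + d))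
    lem = solve-∀
  dist+2meet top      (next q) = lem (dep q)
    where
    lem : ∀ d → 2 + d + 2 * 0 ≡ 2 + (0 + d)
    lem = solve-∀
  dist+2meet (down p) top      = lem (dep p)
    where
    lem : ∀ d → 1 + d + 2 * 1 ≡ 2 + (1 + d + 0)
    lem = solve-∀
  dist+2meet (down p) (down q) = lem (dist p q) (meet p q) (dep p) (dep q) (dist+2meet p q)
    where
    lem : ∀ d m a b → d + 2 * m ≡ 2 + (a + b) → d + 2 * suc m ≡ 2 + (suc a + suc b)
    lem d m a b eq = trans (lhs d m) (trans (cong (2 +_) eq) (rhs a b))
      where
      lhs : ∀ d m → d + 2 * (1 + m) ≡ 2 + (d + 2 * m)
      lhs = solve-∀
      rhs : ∀ a b → 2 + (2 + (a + b)) ≡ 2 + (1 + a + (1 + b))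
      rhs = solve-∀
  dist+2meet (down p) (next q) = lem (dep p) (dep q)
    where
    lem : ∀ a b → 3 + (b + a) + 2 * 0 ≡ 2 + (1 + a + b)
    lem = solve-∀
  dist+2meet (next p) top      = lem (dep p)
    where
    lem : ∀ d → 2 + d + 2 * 0 ≡ 2 + (d + 0)
    lem = solve-∀
  dist+2meet (next p) (down q) = lem (dep p) (dep q)
    where
    lem : ∀ a b → 3 + (b + a) + 2 * 0 ≡ 2 + (a + (1 + b))
    lem = solve-∀
  dist+2meet (next p) (next q) = dist+2meet p q

  -- The ancestors of `q` form a chain from its root, so if both `p` and `s` share its topmost `t`
  -- members, they share them with each other.
  meet-ultra : (p q s : Pos F) {t : ℕ} → t ≤ meet p q → t ≤ meet q s → t ≤ meet p s
  meet-ultra p        q        s        {zero}  _  _  = z≤n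
  meet-ultra top      top      s        {suc t} _  h  = h
  meet-ultra top      (down q) top      {suc t} h  _  = h
  meet-ultra top      (down q) (down s) {suc t} h  _  = h
  meet-ultra top      (down q) (next s) {suc t} _  ()
  meet-ultra top      (next q) s        {suc t} ()
  meet-ultra (down p) top      top      {suc t} h  _  = h
  meet-ultra (down p) top      (down s) {suc t} (s≤s z≤n) _ = s≤s z≤n
  meet-ultra (down p) top      (next s) {suc t} _  ()
  meet-ultra (down p) (down q) top      {suc t} _  h  = h
  meet-ultra (down p) (down q) (down s) {suc t} (s≤s h) (s≤s h′) = s≤s (meet-ultra p q s h h′)
  meet-ultra (down p) (down q) (next s) {suc t} _  ()
  meet-ultra (down p) (next q) s        {suc t} ()
  meet-ultra (next p) top      s        {suc t} ()
  meet-ultra (next p) (down q) s        {suc t} ()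
  meet-ultra (next p) (next q) top      {suc t} _  ()
  meet-ultra (next p) (next q) (down s) {suc t} _  ()
  meet-ultra (next p) (next q) (next s) {suc t} h  h′ = meet-ultra p q s h h′

  meet-sym : (p q : Pos F) → meet p q ≡ meet q p
  meet-sym top      top      = refl
  meet-sym top      (down q) = refl
  meet-sym top      (next q) = refl
  meet-sym (down p) top      = refl
  meet-sym (down p) (down q) = cong suc (meet-sym p q)
  meet-sym (down p) (next q) = refl
  meet-sym (next p) top      = refl
  meet-sym (next p) (down q) = refl
  meet-sym (next p) (next q) = meet-sym p q

  private
    -- By `dist+2meet`, `dist v u ≤ ρ` means that dep u + 2 is at most 2 meet v u + (ρ - dep v).
    -- This survives a smaller depth of the point, a larger meet, and a larger difference between
    -- the radius and the depth of the centre.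
    ball⊆ball : (v w z : Pos F) {ρ σ t : ℕ} → ρ + dep w ≤ σ + dep v → t ≤ meet w z →
                (u : Pos F) → dep z ≤ dep u → meet v u ≤ t → dist v u ≤ ρ → dist w z ≤ σ
    ball⊆ball v w z {ρ} {σ} {t} key t≤ u dz≤ m≤t dvu = +-cancelʳ-≤ (2 * t + dep v) (dist w z) σ (begin
        dist w z + (2 * t + dep v)          ≤⟨ +-monoʳ-≤ (dist w z) (+-monoˡ-≤ (dep v) (*-monoʳ-≤ 2 t≤)) ⟩
        dist w z + (2 * meet w z + dep v)   ≡⟨ +-assoc (dist w z) _ _ ⟨
        dist w z + 2 * meet w z + dep v     ≡⟨ cong (_+ dep v) (dist+2meet w z) ⟩
        2 + (dep w + dep z) + dep v         ≤⟨ +-monoˡ-≤ (dep v) (+-monoʳ-≤ 2 (+-monoʳ-≤ (dep w) dz≤)) ⟩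
        2 + (dep w + dep u) + dep v         ≡⟨ e₁ (dep w) (dep u) (dep v) ⟩
        2 + (dep v + dep u) + dep w         ≡⟨ cong (_+ dep w) (dist+2meet v u) ⟨
        dist v u + 2 * meet v u + dep w     ≤⟨ +-monoˡ-≤ (dep w) (+-mono-≤ dvu (*-monoʳ-≤ 2 m≤t)) ⟩
        ρ + 2 * t + dep w                   ≡⟨ e₂ ρ (2 * t) (dep w) ⟩
        ρ + dep w + 2 * t                   ≤⟨ +-monoˡ-≤ (2 * t) key ⟩
        σ + dep v + 2 * t                   ≡⟨ e₂ σ (dep v) (2 * t) ⟩
        σ + 2 * t + dep v                   ≡⟨ +-assoc σ _ _ ⟩
        σ + (2 * t + dep v)                 ∎)
      where
      open ≤-Reasoning
      e₁ : ∀ a b c → 2 + (a + b) + c ≡ 2 + (c + b) + a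
      e₁ = solve-∀
      e₂ : ∀ a b c → a + b + c ≡ a + c + b
      e₂ = solve-∀

  -- Balls through x are ordered by radius minus depth of the centre, because meet is an ultrametric.
  nested : (v w x z : Pos F) {ρ σ : ℕ} → ρ + dep w ≤ σ + dep v → dep z ≤ dep x →
           dist v x ≤ ρ → dist w x ≤ σ → dist v z ≤ ρ → dist w z ≤ σ
  nested v w x z key dz≤dx dvx dwx dvz with ≤-total (meet v x) (meet w x)
  ... | inj₂ wx≤vx with ≤-total (meet w x) (meet v z)
  -- Here `z` shares at least as many ancestors with `w` as `x` does and is no deeper, so it is no
  -- farther from `w`; the first ball does not enter.
  ...   | inj₁ wx≤vz = ball⊆ball w w z ≤-refl
          (meet-ultra w x z ≤-refl (meet-ultra x v z (subst (_ ≤_) (meet-sym v x) wx≤vx) wx≤vz))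
          x dz≤dx ≤-refl dwx
  ...   | inj₂ vz≤wx = ball⊆ball v w z key
          (meet-ultra w x z vz≤wx
            (meet-ultra x v z (≤-trans vz≤wx (subst (_ ≤_) (meet-sym v x) wx≤vx)) ≤-refl))
          z ≤-refl ≤-refl dvz
  nested v w x z key dz≤dx dvx dwx dvz | inj₁ vx≤wx with ≤-total (meet v x) (meet v z)
  ...   | inj₁ vx≤vz = ball⊆ball v w z key
          (meet-ultra w x z vx≤wx (meet-ultra x v z (≤-reflexive (meet-sym v x)) vx≤vz))
          x dz≤dx ≤-refl dvx
  ...   | inj₂ vz≤vx = ball⊆ball v w z key
          (meet-ultra w x z (≤-trans vz≤vx vx≤wx)
            (meet-ultra x v z (subst (_ ≤_) (meet-sym v x) vz≤vx) ≤-refl))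
          z ≤-refl ≤-refl dvz

-- The fractional cover by balls around all vertices

≤⊔⇒ : ∀ {a} m n → a ≤ m ⊔ n → a ≤ m ⊎ a ≤ n
≤⊔⇒ m n a≤ with ⊔-sel m n
... | inj₁ eq = inj₁ (subst (_ ≤_) eq a≤)
... | inj₂ eq = inj₂ (subst (_ ≤_) eq a≤)

pred≤ : ∀ {a b} → a ≤ suc b → a ∸ 1 ≤ b
pred≤ = ∸-monoˡ-≤ 1

≤1+pred : ∀ a → a ≤ 1 + (a ∸ 1)
≤1+pred a = m≤n+m∸n a 1

-- The weight 2 of the balls of radius h < R makes up for their being smaller than R.
module _ (R : ℕ) where

  opaque
    hit : ℕ → ℕ → ℕ
    hit h δ = (1 + 𝟙 (h <? R)) * 𝟙 (δ ≤? h ⊓ R)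

    hit-low : ∀ {h δ} → h < R → δ ≤ h → hit h δ ≡ 2
    hit-low {h} {δ} h<R δ≤h = cong₂ (λ a b → (1 + a) * b)
      (𝟙-yes (h <? R) h<R) (𝟙-yes (δ ≤? h ⊓ R) (⊓-glb δ≤h (≤-trans δ≤h (<⇒≤ h<R))))

    1≤hit : ∀ {h δ} → δ ≤ h → δ ≤ R → 1 ≤ hit h δ
    1≤hit {h} {δ} δ≤h δ≤R = subst (λ i → 1 ≤ (1 + 𝟙 (h <? R)) * i)
      (sym (𝟙-yes (δ ≤? h ⊓ R) (⊓-glb δ≤h δ≤R))) (s≤s z≤n)

  module _ {V : Set} {E : V → V → Set} where

    private variable
      r : V
      F : Forest {E = E} r

    -- The weight received by a point at distance δ above the roots.
    above : Forest {E = E} r → ℕ → ℕ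
    above F δ = ∑ (positions F) (λ p → hit (height p) (δ + dep p))

    cover : Pos F → ℕ
    cover {F = F} x = ∑ (positions F) (λ p → hit (height p) (dist p x))

    above-cons : ∀ {v} {e : E r v} (c : Forest v) (s : Forest r) δ →
                 above (cons v e c s) δ ≡ hit (levels c) δ + (above c (suc δ) + above s δ)
    above-cons c s δ = trans (∑-positions c s _)
      (cong₂ _+_ (cong (hit (levels c)) (+-identityʳ δ))
        (cong (_+ above s δ) (∑-cong (positions c) (λ p → cong (hit (height p)) (+-suc δ (dep p))))))

    -- Follow a longest downward path. A step down raises δ by 1 and takes away one level. A vertex
    -- of height below `R` pays for both with its weight 2; at greater heights at least `R` levels
    -- remain, so `a` need not drop and weight 1 suffices. Once δ exceeds the height or `R`, nothing
    -- is owed.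
    levels≤above : (F : Forest {E = E} r) {δ a : ℕ} → a ≤ levels F → a ≤ R → a ≤ δ + above F δ

    levels≤above-tree : (c : Forest {E = E} r) {δ a : ℕ} → a ≤ suc (levels c) → a ≤ R →
                        a ≤ δ + (hit (levels c) δ + above c (suc δ))
    levels≤above-tree c {δ} {a} a≤ a≤R with <-≤-connex (levels c) R
    ... | inj₁ ℓ<R with ≤-<-connex δ (levels c)
    ...   | inj₂ ℓ<δ = ≤-trans (≤-trans a≤ ℓ<δ) (m≤m+n δ _)
    ...   | inj₁ δ≤ℓ = begin
      a                                             ≤⟨ ≤1+pred a ⟩
      1 + (a ∸ 1)                                   ≤⟨ s≤s (levels≤above c {suc δ} (pred≤ a≤) (≤-trans (m∸n≤m a 1) a≤R)) ⟩
      1 + (suc δ + above c (suc δ))                 ≡⟨ lem δ (above c (suc δ)) ⟩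
      δ + (2 + above c (suc δ))                     ≡⟨ cong (λ i → δ + (i + above c (suc δ))) (hit-low ℓ<R δ≤ℓ) ⟨
      δ + (hit (levels c) δ + above c (suc δ))      ∎
      where
      open ≤-Reasoning
      lem : ∀ d x → 1 + (1 + d + x) ≡ d + (2 + x)
      lem = solve-∀
    levels≤above-tree c {δ} {a} a≤ a≤R | inj₂ R≤ℓ with ≤-<-connex δ R
    ... | inj₂ R<δ = ≤-trans (≤-trans a≤R (<⇒≤ R<δ)) (m≤m+n δ _)
    ... | inj₁ δ≤R = begin
      a                                             ≤⟨ levels≤above c {suc δ} (≤-trans a≤R R≤ℓ) a≤R ⟩
      suc δ + above c (suc δ)                       ≡⟨ +-suc δ (above c (suc δ)) ⟨
      δ + (1 + above c (suc δ))                     ≤⟨ +-monoʳ-≤ δ (+-monoˡ-≤ _ (1≤hit (≤-trans δ≤R R≤ℓ) δ≤R)) ⟩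
      δ + (hit (levels c) δ + above c (suc δ))      ∎
      where open ≤-Reasoning

    levels≤above ∅ z≤n _ = z≤n
    levels≤above (cons v e c s) {δ} {a} a≤ a≤R with ≤⊔⇒ (suc (levels c)) (levels s) a≤
    ... | inj₁ a≤c = begin
      a                                                             ≤⟨ levels≤above-tree c {δ} a≤c a≤R ⟩
      δ + (hit (levels c) δ + above c (suc δ))                      ≤⟨ +-monoʳ-≤ δ (+-monoʳ-≤ (hit (levels c) δ) (m≤m+n _ _)) ⟩
      δ + (hit (levels c) δ + (above c (suc δ) + above s δ))        ≡⟨ cong (δ +_) (above-cons {e = e} c s δ) ⟨
      δ + above (cons v e c s) δ                                    ∎
      where open ≤-Reasoning
    ... | inj₂ a≤s = begin
      a                                                             ≤⟨ levels≤above s {δ} a≤s a≤R ⟩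
      δ + above s δ                                                 ≤⟨ +-monoʳ-≤ δ (≤-trans (m≤n+m _ (above c (suc δ))) (m≤n+m _ (hit (levels c) δ))) ⟩
      δ + (hit (levels c) δ + (above c (suc δ) + above s δ))        ≡⟨ cong (δ +_) (above-cons {e = e} c s δ) ⟨
      δ + above (cons v e c s) δ                                    ∎
      where open ≤-Reasoning

    module _ {v : V} {e : E r v} {c : Forest {E = E} v} {s : Forest {E = E} r} where

      cover-top : cover {F = cons v e c s} top ≡ hit (levels c) 0 + (above c 1 + above s 2)
      cover-top = ∑-positions c s (λ p → hit (height p) (dist p top))

      cover-down : (x : Pos c) → cover {F = cons v e c s} (down x) ≡
                   hit (levels c) (1 + dep x) + (cover x + above s (3 + dep x))
      cover-down x = ∑-positions c s _

      cover-next : (x : Pos s) → cover {F = cons v e c s} (next x) ≡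
                   hit (levels c) (2 + dep x) + (above c (3 + dep x) + cover x)
      cover-next x = ∑-positions c s _

    -- `x` and all its ancestors have height below `R`, so the ball of each reaches everything
    -- beneath it and contributes 2.
    2+2dep≤cover : (x : Pos F) → levels F < R → 2 + 2 * dep x ≤ cover x
    2+2dep≤cover (top {e = e} {c} {s}) ℓ<R = begin
      2                                               ≡⟨ hit-low (<-≤-trans (m≤m⊔n (suc (levels c)) (levels s)) (<⇒≤ ℓ<R)) z≤n ⟨
      hit (levels c) 0                                ≤⟨ m≤m+n _ _ ⟩
      hit (levels c) 0 + (above c 1 + above s 2)      ≡⟨ cover-top {e = e} {c} {s} ⟨
      cover {F = cons _ e c s} top                    ∎
      where open ≤-Reasoning
    2+2dep≤cover (down {e = e} {c} {s} x) ℓ<R = begin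
      2 + 2 * suc (dep x)                                                  ≡⟨ cong (2 +_) (*-suc 2 (dep x)) ⟩
      2 + (2 + 2 * dep x)                                                  ≤⟨ +-mono-≤ (≤-reflexive (sym (hit-low c<R (dep<levels x))))
                                                                                (≤-trans (2+2dep≤cover x c<R) (m≤m+n _ _)) ⟩
      hit (levels c) (1 + dep x) + (cover x + above s (3 + dep x))         ≡⟨ cover-down {e = e} {c} {s} x ⟨
      cover {F = cons _ e c s} (down x)                                    ∎
      where
      open ≤-Reasoning
      c<R : levels c < R
      c<R = <-≤-trans (m≤m⊔n (suc (levels c)) (levels s)) (<⇒≤ ℓ<R)
    2+2dep≤cover (next {e = e} {c} {s} x) ℓ<R = begin
      2 + 2 * dep x                                                        ≤⟨ 2+2dep≤cover x (≤-<-trans (m≤n⊔m (suc (levels c)) (levels s)) ℓ<R) ⟩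
      cover x                                                              ≤⟨ ≤-trans (m≤n+m _ (above c (3 + dep x))) (m≤n+m _ (hit (levels c) (2 + dep x))) ⟩
      hit (levels c) (2 + dep x) + (above c (3 + dep x) + cover x)         ≡⟨ cover-next {e = e} {c} {s} x ⟨
      cover {F = cons _ e c s} (next x)                                    ∎
      where open ≤-Reasoning

    -- The ancestors of `x` pay for `b`, a longest path for `a`; an ancestor of height below `R` on
    -- that path pays 1 to each. If the longest path lies in a different tree, the distance to it
    -- costs about dep x, which `2+2dep≤cover` makes up for, unless the tree of `x` already has `R`
    -- levels of its own.
    levels+dep≤cover : (x : Pos F) {a b : ℕ} → a ≤ levels F → a ≤ R → b ≤ dep x → b ≤ R → a + b ≤ cover x
    levels+dep≤cover (top {e = e} {c} {s}) {a} a≤ a≤R z≤n _ =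
      ≤-trans (≤-reflexive (+-identityʳ a)) (≤-trans a≤′ (≤-reflexive (sym (cover-top {e = e} {c} {s}))))
      where
      a≤′ : a ≤ hit (levels c) 0 + (above c 1 + above s 2)
      a≤′ with ≤⊔⇒ (suc (levels c)) (levels s) a≤ | <-≤-connex (levels c) R
      ... | inj₁ a≤c | _ = ≤-trans (levels≤above-tree c {0} a≤c a≤R) (+-monoʳ-≤ (hit (levels c) 0) (m≤m+n _ _))
      ... | inj₂ a≤s | inj₁ c<R = ≤-trans (levels≤above s {2} a≤s a≤R)
              (+-mono-≤ (≤-reflexive (sym (hit-low c<R z≤n))) (m≤n+m _ _))
      ... | inj₂ _   | inj₂ R≤c = ≤-trans (levels≤above c {1} (≤-trans a≤R R≤c) a≤R)
              (+-mono-≤ (1≤hit z≤n z≤n) (m≤m+n _ _))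
    levels+dep≤cover (down {e = e} {c} {s} x) {a} {b} a≤ a≤R b≤ b≤R =
      ≤-trans a+b≤ (≤-reflexive (sym (cover-down {e = e} {c} {s} x)))
      where
      open ≤-Reasoning
      split : ∀ a b → 1 + a + (1 + b) ≡ 2 + (a + b)
      split = solve-∀
      a+b≤ : a + b ≤ hit (levels c) (1 + dep x) + (cover x + above s (3 + dep x))
      a+b≤ with <-≤-connex (levels c) R
      a+b≤ | inj₂ R≤c with ≤-<-connex b (dep x)
      ... | inj₁ b≤d = ≤-trans (levels+dep≤cover x (≤-trans a≤R R≤c) a≤R b≤d b≤R)
              (≤-trans (m≤m+n (cover x) _) (m≤n+m _ (hit (levels c) (1 + dep x))))
      ... | inj₂ d<b = begin
        a + b                                                           ≡⟨ cong (a +_) (≤-antisym b≤ d<b) ⟩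
        a + suc (dep x)                                                 ≡⟨ +-suc a (dep x) ⟩
        1 + (a + dep x)                                                 ≤⟨ +-mono-≤ (1≤hit (dep<levels x) (≤-trans d<b b≤R))
                                                                             (≤-trans (levels+dep≤cover x (≤-trans a≤R R≤c) a≤R ≤-refl (<⇒≤ (<-≤-trans d<b b≤R)))
                                                                               (m≤m+n _ _)) ⟩
        hit (levels c) (1 + dep x) + (cover x + above s (3 + dep x))    ∎
      a+b≤ | inj₁ c<R with ≤⊔⇒ (suc (levels c)) (levels s) a≤
      ... | inj₁ a≤c = begin
        a + b                                                           ≤⟨ +-mono-≤ (≤1+pred a) (≤1+pred b) ⟩
        1 + (a ∸ 1) + (1 + (b ∸ 1))                                     ≡⟨ split (a ∸ 1) (b ∸ 1) ⟩
        2 + (a ∸ 1 + (b ∸ 1))                                           ≤⟨ +-mono-≤ (≤-reflexive (sym (hit-low c<R (dep<levels x))))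
                                                                             (≤-trans (levels+dep≤cover x (pred≤ a≤c) (≤-trans (m∸n≤m a 1) a≤R)
                                                                                        (pred≤ b≤) (≤-trans (m∸n≤m b 1) b≤R))
                                                                               (m≤m+n _ _)) ⟩
        hit (levels c) (1 + dep x) + (cover x + above s (3 + dep x))    ∎
      ... | inj₂ a≤s = begin
        a + b                                                           ≤⟨ +-mono-≤ (levels≤above s {3 + dep x} a≤s a≤R) b≤ ⟩
        3 + dep x + above s (3 + dep x) + suc (dep x)                   ≡⟨ lem (dep x) (above s (3 + dep x)) ⟩
        2 + (2 + 2 * dep x + above s (3 + dep x))                       ≤⟨ +-mono-≤ (≤-reflexive (sym (hit-low c<R (dep<levels x))))
                                                                             (+-monoˡ-≤ _ (2+2dep≤cover x c<R)) ⟩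
        hit (levels c) (1 + dep x) + (cover x + above s (3 + dep x))    ∎
        where
        lem : ∀ d u → 3 + d + u + (1 + d) ≡ 2 + (2 + 2 * d + u)
        lem = solve-∀
    levels+dep≤cover (next {e = e} {c} {s} x) {a} {b} a≤ a≤R b≤ b≤R =
      ≤-trans a+b≤ (≤-reflexive (sym (cover-next {e = e} {c} {s} x)))
      where
      open ≤-Reasoning
      lem : ∀ d h u → 2 + d + (h + u) + d ≡ h + (u + (2 + 2 * d))
      lem = solve-∀
      a≤s⇒ : a ≤ levels s → a + b ≤ hit (levels c) (2 + dep x) + (above c (3 + dep x) + cover x)
      a≤s⇒ a≤s = ≤-trans (levels+dep≤cover x a≤s a≤R b≤ b≤R)
                 (≤-trans (m≤n+m _ (above c (3 + dep x))) (m≤n+m _ (hit (levels c) (2 + dep x))))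
      a+b≤ : a + b ≤ hit (levels c) (2 + dep x) + (above c (3 + dep x) + cover x)
      a+b≤ with ≤⊔⇒ (suc (levels c)) (levels s) a≤ | <-≤-connex (levels s) R
      ... | inj₂ a≤s | _        = a≤s⇒ a≤s
      ... | inj₁ _   | inj₂ R≤s = a≤s⇒ (≤-trans a≤R R≤s)
      ... | inj₁ a≤c | inj₁ s<R = begin
        a + b                                                               ≤⟨ +-mono-≤ (levels≤above-tree c {2 + dep x} a≤c a≤R) b≤ ⟩
        2 + dep x + (hit (levels c) (2 + dep x) + above c (3 + dep x)) + dep x
                                                                            ≡⟨ lem (dep x) (hit (levels c) (2 + dep x)) _ ⟩
        hit (levels c) (2 + dep x) + (above c (3 + dep x) + (2 + 2 * dep x))
                                                                            ≤⟨ +-monoʳ-≤ (hit (levels c) (2 + dep x)) (+-monoʳ-≤ (above c (3 + dep x)) (2+2dep≤cover x s<R)) ⟩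
        hit (levels c) (2 + dep x) + (above c (3 + dep x) + cover x)        ∎

    -- Beyond distance `R` from the root, `levels+dep≤cover` applies with both parts equal to `R`.
    -- Nearer to it, the extra weight of the root suffices alone.
    2R≤cover : {v : V} {e : E r v} {c : Forest {E = E} v} (x : Pos (cons v e c ∅)) →
               2 * R ≤ cover x + 2 * R * 𝟙 (dist top x ≤? R)
    2R≤cover {e = e} {c} x with ≤-<-connex (dist top x) R
    ... | inj₁ d≤R = begin
      2 * R                                       ≡⟨ *-identityʳ (2 * R) ⟨
      2 * R * 1                                   ≡⟨ cong (2 * R *_) (𝟙-yes (dist top x ≤? R) d≤R) ⟨
      2 * R * 𝟙 (dist top x ≤? R)                 ≤⟨ m≤n+m _ (cover x) ⟩
      cover x + 2 * R * 𝟙 (dist top x ≤? R)       ∎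
      where open ≤-Reasoning
    ... | inj₂ R<d = ≤-trans (≤-trans (≤-reflexive (cong (R +_) (+-identityʳ R)))
                       (levels+dep≤cover x (<⇒≤ (≤-<-trans R≤dep (dep<levels x))) ≤-refl R≤dep ≤-refl))
                     (m≤m+n (cover x) _)
      where
      dist≡dep : (x : Pos (cons _ e c ∅)) → dist top x ≡ dep x
      dist≡dep top      = refl
      dist≡dep (down x) = refl
      R≤dep : R ≤ dep x
      R≤dep = subst (R ≤_) (dist≡dep x) (<⇒≤ R<d)

-- Covering duality for nested balls

argmin : {B : Set} {P : B → Set} → (∀ b → Dec (P b)) → (s : B → ℕ) (bs : List B) →
         Any.Any P bs → ∃ λ b → P b × (∀ b′ → b′ ∈ bs → P b′ → s b ≤ s b′)
argmin P? s (b ∷ bs) any with P? b | Any.any? P? bs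
... | no ¬p | no ¬any = ⊥-elim (¬any (Any.tail ¬p any))
... | yes p | no ¬any = b , p , λ where
  _  (here refl) _  → ≤-refl
  b′ (there b′∈) p′ → ⊥-elim (¬any (lose b′∈ p′))
... | no ¬p | yes any′ with argmin P? s bs any′
...   | c , pc , min = c , pc , λ where
  _  (here refl) p′ → ⊥-elim (¬p p′)
  b′ (there b′∈) p′ → min b′ b′∈ p′
argmin P? s (b ∷ bs) any | yes p | yes any′ with argmin P? s bs any′
... | c , pc , min with ≤-total (s b) (s c)
...   | inj₁ b≤c = b , p , λ where
  _  (here refl) _  → ≤-refl
  b′ (there b′∈) p′ → ≤-trans b≤c (min b′ b′∈ p′)
...   | inj₂ c≤b = c , pc , λ where
  _  (here refl) _  → c≤b
  b′ (there b′∈) p′ → min b′ b′∈ p′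

-- If the points can be ordered so that the balls through any point are nested on the later points, there is
-- no gap between integral covers and fractional packings.
module _ {A B : Set} (_∋_ : B → A → Set) (_∋?_ : ∀ b x → Dec (b ∋ x)) where

  Covers : List B → A → Set
  Covers C x = Any.Any (_∋ x) C

  Nested : List A → Set
  Nested []       = ⊤
  Nested (x ∷ xs) = (∀ b c → b ∋ x → c ∋ x →
    (∀ z → z ∈ xs → b ∋ z → c ∋ z) ⊎ (∀ z → z ∈ xs → c ∋ z → b ∋ z)) × Nested xs

  load : List (A × ℕ) → B → ℕ
  load ys b = ∑ ys (λ (x , m) → m * 𝟙 (b ∋? x))

  AtMostOnce : A → List B → Set
  AtMostOnce x C = All (λ b → ¬ (b ∋ x)) C ⊎
    (∃ λ b → ∃ λ C′ → C ≡ b ∷ C′ × b ∋ x × All (λ b → ¬ (b ∋ x)) C′)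

  prune : ∀ x xs → Nested (x ∷ xs) → (s : B → ℕ) (C : List B) →
          ∃ λ C′ → (∀ z → z ∈ xs → Covers C z → Covers C′ z) × ∑ C′ s ≤ ∑ C s × AtMostOnce x C′
  prune x xs nst s [] = [] , (λ _ _ c → c) , z≤n , inj₁ []
  prune x xs nst s (c ∷ C) with prune x xs nst s C | c ∋? x
  ... | C′ , keep , cheap , inj₁ none | no c∌x =
    c ∷ C′ , (λ where z z∈ (here c∋z) → here c∋z
                      z z∈ (there C∋z) → there (keep z z∈ C∋z)) ,
    +-monoʳ-≤ (s c) cheap , inj₁ (c∌x ∷ none)
  ... | C′ , keep , cheap , inj₁ none | yes c∋x =
    c ∷ C′ , (λ where z z∈ (here c∋z) → here c∋z
                      z z∈ (there C∋z) → there (keep z z∈ C∋z)) ,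
    +-monoʳ-≤ (s c) cheap , inj₂ (c , C′ , refl , c∋x , none)
  ... | .(b ∷ C′) , keep , cheap , inj₂ (b , C′ , refl , b∋x , none) | no c∌x =
    b ∷ c ∷ C′ , (λ where z z∈ (here c∋z) → there (here c∋z)
                          z z∈ (there C∋z) → swap (keep z z∈ C∋z)) ,
    ≤-trans (≤-reflexive (comm (s b) (s c) (∑ C′ s))) (+-monoʳ-≤ (s c) cheap) ,
    inj₂ (b , c ∷ C′ , refl , b∋x , c∌x ∷ none)
    where
    swap : ∀ {z} → Covers (b ∷ C′) z → Covers (b ∷ c ∷ C′) z
    swap (here b∋z)  = here b∋z
    swap (there C∋z) = there (there C∋z)
    comm : ∀ p q r → p + (q + r) ≡ q + (p + r)
    comm = solve-∀
  ... | .(b ∷ C′) , keep , cheap , inj₂ (b , C′ , refl , b∋x , none) | yes c∋x with proj₁ nst b c b∋x c∋x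
  ...   | inj₁ b⊆c = c ∷ C′ , keep′ , +-monoʳ-≤ (s c) (≤-trans (m≤n+m _ (s b)) cheap) ,
                     inj₂ (c , C′ , refl , c∋x , none)
    where
    keep′ : ∀ z → z ∈ xs → Covers (c ∷ C) z → Covers (c ∷ C′) z
    keep′ z z∈ (here c∋z) = here c∋z
    keep′ z z∈ (there C∋z) with keep z z∈ C∋z
    ... | here b∋z  = here (b⊆c z z∈ b∋z)
    ... | there C∋z = there C∋z
  ...   | inj₂ c⊆b = b ∷ C′ , (λ where z z∈ (here c∋z) → here (c⊆b z z∈ c∋z)
                                       z z∈ (there C∋z) → keep z z∈ C∋z) ,
                     ≤-trans cheap (m≤n+m _ (s c)) , inj₂ (b , C′ , refl , b∋x , none)

  -- A primal-dual greedy. The first point `x` receives as mass the least price of a ball through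
  -- it; this is subtracted from all balls through `x`, and the later points are handled at the
  -- reduced prices. After pruning, at most one ball of the cover contains `x`, so restoring the
  -- prices costs that mass at most once. If none does, the cheapest ball through `x` is added for
  -- exactly that mass.
  duality : (bs : List B) (xs : List A) → Nested xs → (∀ x → x ∈ xs → Covers bs x) → (s : B → ℕ) →
            ∃ λ ys → ∃ λ C → (∀ b → b ∈ bs → load ys b ≤ s b) ×
                             (∀ x → x ∈ xs → Covers C x) × ∑ C s ≤ ∑ ys proj₂
  duality bs []       _   _   s = [] , [] , (λ _ _ → z≤n) , (λ _ ()) , z≤n
  duality bs (x ∷ xs) nst cov s with argmin (_∋? x) s bs (cov x (here refl))
  ... | b₀ , b₀∋x , min
    with duality bs xs (proj₂ nst) (λ z z∈ → cov z (there z∈)) (λ b → s b ∸ s b₀ * 𝟙 (b ∋? x))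
  ...   | ys , C , load≤ , covC , cost
    with prune x xs nst (λ b → s b ∸ s b₀ * 𝟙 (b ∋? x)) C
  ...     | C′ , keep , cheap , once with extend once
    where
    m = s b₀
    s′ : B → ℕ
    s′ b = s b ∸ m * 𝟙 (b ∋? x)
    s≤s′ : ∀ b → ¬ (b ∋ x) → s b ≤ s′ b
    s≤s′ b b∌x = ≤-reflexive (cong (s b ∸_) (sym (trans (cong (m *_) (𝟙-no (b ∋? x) b∌x)) (*-zeroʳ m))))
    s≤s′+m : ∀ b → s b ≤ m + s′ b
    s≤s′+m b = ≤-trans (m≤n+m∸n (s b) m) (+-monoʳ-≤ m (∸-monoʳ-≤ (s b) m𝟙≤m))
      where
      m𝟙≤m : m * 𝟙 (b ∋? x) ≤ m
      m𝟙≤m with b ∋? x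
      ... | yes _ = ≤-reflexive (*-identityʳ m)
      ... | no _  = ≤-trans (≤-reflexive (*-zeroʳ m)) z≤n
    extend : AtMostOnce x C′ → ∃ λ C″ → (∀ z → Covers C′ z → Covers C″ z) × Covers C″ x × ∑ C″ s ≤ m + ∑ C′ s′
    extend (inj₁ none) = b₀ ∷ C′ , (λ _ → there) , here b₀∋x ,
      +-monoʳ-≤ m (∑-mono C′ (λ b b∈ → s≤s′ b (All.lookup none b∈)))
    extend (inj₂ (b , C₀ , refl , b∋x , none)) = b ∷ C₀ , (λ _ c → c) , here b∋x ,
      ≤-trans (+-mono-≤ (s≤s′+m b) (∑-mono C₀ (λ b b∈ → s≤s′ b (All.lookup none b∈))))
        (≤-reflexive (+-assoc m _ _))
  ...       | C″ , mono , C″∋x , cost″ =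
    (x , s b₀) ∷ ys , C″ , load≤′ ,
    (λ where z (here refl) → C″∋x
             z (there z∈) → mono z (keep z z∈ (covC z z∈))) ,
    ≤-trans cost″ (+-monoʳ-≤ (s b₀) (≤-trans cheap cost))
    where
    m𝟙≤s : ∀ b → b ∈ bs → s b₀ * 𝟙 (b ∋? x) ≤ s b
    m𝟙≤s b b∈ with b ∋? x
    ... | yes b∋x = ≤-trans (≤-reflexive (*-identityʳ (s b₀))) (min b b∈ b∋x)
    ... | no _    = ≤-trans (≤-reflexive (*-zeroʳ (s b₀))) z≤n
    load≤′ : ∀ b → b ∈ bs → s b₀ * 𝟙 (b ∋? x) + load ys b ≤ s b
    load≤′ b b∈ = ≤-trans (+-monoʳ-≤ (s b₀ * 𝟙 (b ∋? x)) (load≤ b b∈)) (≤-reflexive (m+[n∸m]≡n (m𝟙≤s b b∈)))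

-- Minimal ratios and averages of monotone sequences

-- The quotients f r / r² with 1 ≤ r ≤ x + 1 are compared by cross multiplication; transitivity then
-- requires cancelling the square of the middle index.
least-ratio : (f : ℕ → ℕ) (x : ℕ) → ∃ λ q → suc q ≤ suc x ×
              (∀ p → p ≤ x → f (suc q) * (suc p * suc p) ≤ f (suc p) * (suc q * suc q))
least-ratio f zero    = 0 , ≤-refl , λ where zero z≤n → ≤-refl
least-ratio f (suc x) with least-ratio f x
... | q , q≤x , min with ≤-total (f (suc q) * ((2 + x) * (2 + x))) (f (2 + x) * (suc q * suc q))
...   | inj₁ q-best = q , m≤n⇒m≤1+n q≤x , λ p p≤ → case p p≤
  where
  case : ∀ p → p ≤ suc x → f (suc q) * (suc p * suc p) ≤ f (suc p) * (suc q * suc q)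
  case p p≤ with m≤n⇒m<n∨m≡n p≤
  ... | inj₁ (s≤s p≤x) = min p p≤x
  ... | inj₂ refl      = q-best
...   | inj₂ x-best = suc x , ≤-refl , λ p p≤ → case p p≤
  where
  open ≤-Reasoning
  comm : ∀ a b c → a * b * c ≡ a * c * b
  comm = solve-∀
  case : ∀ p → p ≤ suc x → f (2 + x) * (suc p * suc p) ≤ f (suc p) * ((2 + x) * (2 + x))
  case p p≤ with m≤n⇒m<n∨m≡n p≤
  ... | inj₂ refl      = ≤-refl
  ... | inj₁ (s≤s p≤x) = *-cancelʳ-≤ _ _ (suc q * suc q) (begin
    f (2 + x) * (suc p * suc p) * (suc q * suc q)       ≡⟨ comm (f (2 + x)) _ _ ⟩
    f (2 + x) * (suc q * suc q) * (suc p * suc p)       ≤⟨ *-monoˡ-≤ (suc p * suc p) x-best ⟩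
    f (suc q) * ((2 + x) * (2 + x)) * (suc p * suc p)   ≡⟨ comm (f (suc q)) _ _ ⟩
    f (suc q) * (suc p * suc p) * ((2 + x) * (2 + x))   ≤⟨ *-monoˡ-≤ ((2 + x) * (2 + x)) (min p p≤x) ⟩
    f (suc p) * (suc q * suc q) * ((2 + x) * (2 + x))   ≡⟨ comm (f (suc p)) _ _ ⟩
    f (suc p) * ((2 + x) * (2 + x)) * (suc q * suc q)   ∎)

∑-below : (f : ℕ → ℕ) {b c : ℕ} (a : ℕ) → (∀ t → t < a → f (t + b) ≤ c) →
          ∑ (downFrom (a + b)) f ≤ a * c + ∑ (downFrom b) f
∑-below f         zero    f≤ = ≤-refl
∑-below f {b} {c} (suc a) f≤ = ≤-trans
  (+-mono-≤ (f≤ a ≤-refl) (∑-below f a (λ t t<a → f≤ t (m≤n⇒m≤1+n t<a))))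
  (≤-reflexive (sym (+-assoc c (a * c) _)))

∑-above : (f : ℕ → ℕ) {b c : ℕ} (a : ℕ) → (∀ t → c ≤ f (t + b)) →
          a * c + ∑ (downFrom b) f ≤ ∑ (downFrom (a + b)) f
∑-above f         zero    f≥ = ≤-refl
∑-above f {b} {c} (suc a) f≥ = ≤-trans (≤-reflexive (+-assoc c (a * c) _)) (+-mono-≤ (f≥ a) (∑-above f a f≥))

module _ (w : ℕ → ℕ) (w-mono : ∀ {i j} → i ≤ j → w i ≤ w j) where

  private
    W : ℕ → ℕ
    W d = ∑ (downFrom d) w

  average-mono : ∀ {d R} → d ≤ R → R * W d ≤ d * W R
  average-mono {d} {R} d≤R with R ∸ d | m∸n+n≡m d≤R
  ... | e | refl = begin
    (e + d) * W d                       ≡⟨ *-distribʳ-+ (W d) e d ⟩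
    e * W d + d * W d                   ≤⟨ +-monoˡ-≤ (d * W d) (*-monoʳ-≤ e W≤) ⟩
    e * (d * w d) + d * W d             ≡⟨ lem e d (w d) (W d) ⟩
    d * (e * w d + W d)                 ≤⟨ *-monoʳ-≤ d (∑-above w e (λ t → w-mono (m≤n+m d t))) ⟩
    d * W (e + d)                       ∎
    where
    open ≤-Reasoning
    lem : ∀ e d x y → e * (d * x) + d * y ≡ d * (e * x + y)
    lem = solve-∀
    W≤ : W d ≤ d * w d
    W≤ = subst₂ (λ i j → W i ≤ j) (+-identityʳ d) (+-identityʳ (d * w d))
      (∑-below w {0} d (λ t t<d → w-mono (≤-trans (≤-reflexive (+-identityʳ t)) (<⇒≤ t<d))))

  -- With R = q + 1, minimality against R - 1 reads W(R) (R - 1)² ≤ (W(R) - w q) R², so w q R² ≤ (2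
  -- R - 1) W(R).
  last≤2average : ∀ q → (∀ p → p < q → W (suc q) * (suc p * suc p) ≤ W (suc p) * (suc q * suc q)) →
                  suc q * w q ≤ 2 * W (suc q)
  last≤2average zero     min = m≤m+n (w 0 + 0) _
  last≤2average (suc q)  min = *-cancelʳ-≤ _ _ (3 + 2 * q) (≤-from (*-monoʳ-≤ 2 (min q ≤-refl))
      {(2 + q) * x * (3 + 2 * q)} (x * (2 + q)) (lem x (W (suc q)) q))
    where
    x = w (suc q)
    lem : ∀ x y q → (2 + q) * x * (3 + 2 * q) + 2 * (y * ((2 + q) * (2 + q))) + x * (2 + q) ≡
          2 * ((x + y) * ((1 + q) * (1 + q))) + 2 * (x + y) * (3 + 2 * q)
    lem = solve-∀

-- Bounding the total mass of a weighting

module _ {V : Set} {E : V → V → Set} (γ : ℕ → ℕ) (K : ℕ) (γ-average : ∀ ℓ → ∑ (downFrom ℓ) γ ≤ K * ℓ) where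

  private variable
    r : V

  private
    S : Forest {E = E} r → ℕ
    S F = ∑ (positions F) (λ p → γ (height p))

  -- Decomposing the forest into longest downward paths, each path sees the heights 0, 1, 2, ...
  ∑-height-strong : (F : Forest {E = E} r) → S F + K * levels F ≤ K * size F + ∑ (downFrom (levels F)) γ

  ∑-height≤ : (F : Forest {E = E} r) → S F ≤ K * size F
  ∑-height≤ F = +-cancelʳ-≤ (K * levels F) _ _
    (≤-trans (∑-height-strong F) (+-monoʳ-≤ (K * size F) (γ-average (levels F))))

  ∑-height-strong ∅ = m≤m+n (K * 0) 0
  ∑-height-strong (cons v e c s) with ⊔-sel (suc (levels c)) (levels s)
  ... | inj₁ eq = begin
    S (cons v e c s) + K * (suc (levels c) ⊔ levels s)
      ≡⟨ cong₂ (λ i j → i + K * j) (∑-positions {e = e} c s _) eq ⟩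
    γ (levels c) + (S c + S s) + K * suc (levels c)
      ≡⟨ lem₁ (γ (levels c)) (S c) (S s) K (levels c) ⟩
    S c + K * levels c + S s + (γ (levels c) + K)
      ≤⟨ +-monoˡ-≤ (γ (levels c) + K) (+-mono-≤ (∑-height-strong c) (∑-height≤ s)) ⟩
    K * size c + ∑ (downFrom (levels c)) γ + K * size s + (γ (levels c) + K)
      ≡⟨ lem₂ (γ (levels c)) (∑ (downFrom (levels c)) γ) K (size c) (size s) ⟩
    K * suc (size c + size s) + ∑ (downFrom (suc (levels c))) γ
      ≡⟨ cong (λ i → K * suc (size c + size s) + ∑ (downFrom i) γ) eq ⟨
    K * suc (size c + size s) + ∑ (downFrom (suc (levels c) ⊔ levels s)) γ ∎
    where
    open ≤-Reasoning
    lem₁ : ∀ g c s K l → g + (c + s) + K * (1 + l) ≡ c + K * l + s + (g + K)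
    lem₁ = solve-∀
    lem₂ : ∀ g t K c s → K * c + t + K * s + (g + K) ≡ K * (1 + (c + s)) + (g + t)
    lem₂ = solve-∀
  -- The siblings are at least as deep: the longest path through `v` ends at `v` and its
  -- `suc (levels c)` heights are averaged now, while the path in `s` stays open towards its parent.
  ... | inj₂ eq = +-cancelʳ-≤ (K * levels c) _ _ (begin
    S (cons v e c s) + K * (suc (levels c) ⊔ levels s) + K * levels c
      ≡⟨ cong₂ (λ i j → i + K * j + K * levels c) (∑-positions {e = e} c s _) eq ⟩
    γ (levels c) + (S c + S s) + K * levels s + K * levels c
      ≡⟨ lem₁ (γ (levels c)) (S c) (S s) (K * levels s) (K * levels c) ⟩
    S c + K * levels c + (S s + K * levels s) + γ (levels c)
      ≤⟨ +-monoˡ-≤ (γ (levels c)) (+-mono-≤ (∑-height-strong c) (∑-height-strong s)) ⟩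
    K * size c + ∑ (downFrom (levels c)) γ + (K * size s + ∑ (downFrom (levels s)) γ) + γ (levels c)
      ≡⟨ lem₂ (γ (levels c)) (∑ (downFrom (levels c)) γ) (∑ (downFrom (levels s)) γ) K (size c) (size s) ⟩
    ∑ (downFrom (suc (levels c))) γ + (K * size c + K * size s + ∑ (downFrom (levels s)) γ)
      ≤⟨ +-monoˡ-≤ _ (γ-average (suc (levels c))) ⟩
    K * suc (levels c) + (K * size c + K * size s + ∑ (downFrom (levels s)) γ)
      ≡⟨ lem₃ (∑ (downFrom (levels s)) γ) K (size c) (size s) (levels c) ⟩
    K * suc (size c + size s) + ∑ (downFrom (levels s)) γ + K * levels c
      ≡⟨ cong (λ i → K * suc (size c + size s) + ∑ (downFrom i) γ + K * levels c) eq ⟨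
    K * suc (size c + size s) + ∑ (downFrom (suc (levels c) ⊔ levels s)) γ + K * levels c ∎)
    where
    open ≤-Reasoning
    lem₁ : ∀ g c s l m → g + (c + s) + l + m ≡ c + m + (s + l) + g
    lem₁ = solve-∀
    lem₂ : ∀ g t u K c s → K * c + t + (K * s + u) + g ≡ g + t + (K * c + K * s + u)
    lem₂ = solve-∀
    lem₃ : ∀ u K c s l → K * (1 + l) + (K * c + K * s + u) ≡ K * (1 + (c + s)) + u + K * l
    lem₃ = solve-∀

dist-refl : {V : Set} {E : V → V → Set} {r : V} {F : Forest {E = E} r} (p : Pos F) → dist p p ≡ 0
dist-refl top      = refl
dist-refl (down p) = dist-refl p
dist-refl (next p) = dist-refl p

module _ {V : Set} {E : V → V → Set} {r v : V} (e : E r v) (G : Forest {E = E} v) where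

  private
    T : Forest {E = E} r
    T = cons v e G ∅

  mass : List (Pos T × ℕ) → Pos T → ℕ → ℕ
  mass ys p ρ = ∑ ys (λ (x , m) → m * 𝟙 (dist p x ≤? ρ))

  mass-mono : ∀ ys p {ρ σ} → ρ ≤ σ → mass ys p ρ ≤ mass ys p σ
  mass-mono ys p {ρ} {σ} ρ≤σ = ∑-mono ys (λ (x , m) _ →
    *-monoʳ-≤ m (𝟙-mono (dist p x ≤? ρ) (dist p x ≤? σ) (λ d≤ → ≤-trans d≤ ρ≤σ)))

  module _ (ys : List (Pos T × ℕ)) (w : ℕ → ℕ) (w-mono : ∀ {i j} → i ≤ j → w i ≤ w j)
           (mass≤w : ∀ p i → mass ys p (suc i) ≤ w i) where

    private
      W : ℕ → ℕ
      W d = ∑ (downFrom d) w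

      Y : ℕ
      Y = ∑ ys proj₂

    module _ (q : ℕ) where

      private
        R = suc q

        -- A bound for the weighted mass of the ball at a vertex of height `h`. Index i of `w`
        -- stands for radius i + 1, and the radius `h ⊓ R` is at most 1 + (h ⊓ q).
        γ : ℕ → ℕ
        γ h = (1 + 𝟙 (h <? R)) * w (h ⊓ q)

      opaque
        unfolding hit

        hit-mass : ∀ p → ∑ ys (λ (x , m) → m * hit R (height p) (dist p x)) ≤ γ (height p)
        hit-mass p = begin
          ∑ ys (λ (x , m) → m * (c * 𝟙 (dist p x ≤? height p ⊓ R)))
            ≡⟨ ∑-cong ys (λ (x , m) → comm m c _) ⟩
          ∑ ys (λ (x , m) → c * (m * 𝟙 (dist p x ≤? height p ⊓ R)))
            ≡⟨ ∑-* c ys _ ⟩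
          c * mass ys p (height p ⊓ R)
            ≤⟨ *-monoʳ-≤ c (≤-trans (mass-mono ys p ⊓≤) (mass≤w p (height p ⊓ q))) ⟩
          c * w (height p ⊓ q) ∎
          where
          open ≤-Reasoning
          c : ℕ
          c = 1 + 𝟙 (height p <? R)
          comm : ∀ a b c → a * (b * c) ≡ b * (a * c)
          comm = solve-∀
          ⊓≤ : height p ⊓ R ≤ suc (height p ⊓ q)
          ⊓≤ = ⊓-monoˡ-≤ R (n≤1+n (height p))

      -- Double counting: the mass at each point, times the weight of the balls through it, summed
      -- over points or over balls.
      2RY≤ : 2 * R * Y ≤ ∑ (positions T) (λ p → γ (height p)) + 2 * R * w q
      2RY≤ = begin
        2 * R * Y
          ≡⟨ ∑-* (2 * R) ys proj₂ ⟨
        ∑ ys (λ (x , m) → 2 * R * m)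
          ≤⟨ ∑-mono ys (λ (x , m) _ → ≤-trans (*-monoˡ-≤ m (2R≤cover R {e = e} x)) (≤-reflexive (lem _ (2 * R) _ m))) ⟩
        ∑ ys (λ (x , m) → m * cover R x + 2 * R * (m * 𝟙 (dist (top {e = e} {s = ∅}) x ≤? R)))
          ≡⟨ ∑-+ ys _ _ ⟩
        ∑ ys (λ (x , m) → m * cover R x) + ∑ ys (λ (x , m) → 2 * R * (m * 𝟙 (dist top x ≤? R)))
          ≡⟨ cong₂ _+_ (∑-cong ys (λ (x , m) → ∑-* m (positions T) _)) (sym (∑-* (2 * R) ys _)) ⟨
        ∑ ys (λ (x , m) → ∑ (positions T) (λ p → m * hit R (height p) (dist p x))) + 2 * R * mass ys top R
          ≡⟨ cong (_+ 2 * R * mass ys top R) (∑-swap ys (positions T) _) ⟩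
        ∑ (positions T) (λ p → ∑ ys (λ (x , m) → m * hit R (height p) (dist p x))) + 2 * R * mass ys top R
          ≤⟨ +-mono-≤ (∑-mono (positions T) (λ p _ → hit-mass p)) (*-monoʳ-≤ (2 * R) (mass≤w top q)) ⟩
        ∑ (positions T) (λ p → γ (height p)) + 2 * R * w q ∎
        where
        open ≤-Reasoning
        lem : ∀ c R i m → (c + R * i) * m ≡ m * c + R * (m * i)
        lem = solve-∀

      module _ (min : ∀ p → p < q → W R * (suc p * suc p) ≤ W (suc p) * (R * R)) where

        private
          -- Below height `R`, weight 2 gives at most twice an average of the monotone `w`; from `R`
          -- on, `γ` is constantly `w q`, which `last≤2average` bounds by the same quantity.
          Rγ-average : ∀ ℓ → ∑ (downFrom ℓ) (λ h → R * γ h) ≤ 2 * W R * ℓ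
          Rγ-average ℓ with ≤-<-connex ℓ R
          ... | inj₁ ℓ≤R = begin
            ∑ (downFrom ℓ) (λ h → R * γ h)      ≤⟨ ∑-mono (downFrom ℓ) (λ h h∈ → *-monoʳ-≤ R (γ≤ h (<-≤-trans (∈-downFrom⁻ h∈) ℓ≤R))) ⟩
            ∑ (downFrom ℓ) (λ h → R * (2 * w h))  ≡⟨ trans (∑-* R (downFrom ℓ) _) (cong (R *_) (∑-* 2 (downFrom ℓ) w)) ⟩
            R * (2 * W ℓ)                       ≡⟨ comm R (W ℓ) ⟩
            2 * (R * W ℓ)                       ≤⟨ *-monoʳ-≤ 2 (average-mono w w-mono ℓ≤R) ⟩
            2 * (ℓ * W R)                       ≡⟨ comm′ ℓ (W R) ⟩
            2 * W R * ℓ                         ∎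
            where
            open ≤-Reasoning
            comm : ∀ a b → a * (2 * b) ≡ 2 * (a * b)
            comm = solve-∀
            comm′ : ∀ a b → 2 * (a * b) ≡ 2 * b * a
            comm′ = solve-∀
            γ≤ : ∀ h → h < R → γ h ≤ 2 * w h
            γ≤ h h<R = *-mono-≤ (s≤s (𝟙-mono (h <? R) (yes tt) (λ _ → tt))) (w-mono (m⊓n≤m h q))
          Rγ-average (suc ℓ) | inj₂ (s≤s R≤ℓ) = begin
            R * γ ℓ + ∑ (downFrom ℓ) (λ h → R * γ h)      ≤⟨ +-mono-≤ Rγ≤ (Rγ-average ℓ) ⟩
            2 * W R + 2 * W R * ℓ                         ≡⟨ *-suc (2 * W R) ℓ ⟨
            2 * W R * suc ℓ                               ∎
            where
            open ≤-Reasoning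
            Rγ≤ : R * γ ℓ ≤ 2 * W R
            Rγ≤ = ≤-trans (≤-reflexive (cong (R *_) (trans
                      (cong₂ (λ i j → (1 + i) * w j) (𝟙-no (ℓ <? R) (≤⇒≯ R≤ℓ)) (m≥n⇒m⊓n≡n (≤-trans (n≤1+n q) R≤ℓ)))
                      (*-identityˡ (w q)))))
                    (last≤2average w w-mono q min)

        R²Y≤ : R * R * Y ≤ W R * (size T + 2 * R)
        R²Y≤ = *-cancelˡ-≤ 2 (begin
          2 * (R * R * Y)                                                        ≡⟨ lem₁ R Y ⟩
          R * (2 * R * Y)                                                        ≤⟨ *-monoʳ-≤ R 2RY≤ ⟩
          R * (∑ (positions T) (λ p → γ (height p)) + 2 * R * w q)               ≡⟨ lem₂ R (∑ (positions T) (λ p → γ (height p))) (w q) ⟩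
          R * ∑ (positions T) (λ p → γ (height p)) + 2 * R * (R * w q)           ≡⟨ cong (_+ 2 * R * (R * w q)) (∑-* R (positions T) (λ p → γ (height p))) ⟨
          ∑ (positions T) (λ p → R * γ (height p)) + 2 * R * (R * w q)           ≤⟨ +-mono-≤ (∑-height≤ (λ h → R * γ h) (2 * W R) Rγ-average T)
                                                                                      (*-monoʳ-≤ (2 * R) (last≤2average w w-mono q min)) ⟩
          2 * W R * size T + 2 * R * (2 * W R)                                   ≡⟨ lem₃ (W R) R (size T) ⟩
          2 * (W R * (size T + 2 * R))                                           ∎)
          where
          open ≤-Reasoning
          lem₁ : ∀ R Y → 2 * (R * R * Y) ≡ R * (2 * R * Y)
          lem₁ = solve-∀
          lem₂ : ∀ R a b → R * (a + 2 * R * b) ≡ R * a + 2 * R * (R * b)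
          lem₂ = solve-∀
          lem₃ : ∀ W R n → 2 * W * n + 2 * R * (2 * W) ≡ 2 * (W * (n + 2 * R))
          lem₃ = solve-∀

    -- For the minimiser `R` up to `X`, the ratio W(R) / R² in `R²Y≤` is at most W(X) / X²; only the
    -- root term grows, from 2 R to 2 X.
    X²Y≤ : ∀ X → X * X * Y ≤ W X * (size T + 2 * X)
    X²Y≤ zero    = z≤n
    X²Y≤ X@(suc x) with least-ratio W x
    ... | q , R≤X , min = *-cancelʳ-≤ _ _ (R * R) (begin
      X * X * Y * (R * R)                         ≡⟨ lem₁ X Y R ⟩
      X * X * (R * R * Y)                         ≤⟨ *-monoʳ-≤ (X * X) (R²Y≤ q (λ p p<q → min p (≤-trans (<⇒≤ p<q) (s≤s⁻¹ R≤X)))) ⟩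
      X * X * (W R * (size T + 2 * R))            ≡⟨ lem₂ X (W R) _ ⟩
      W R * (X * X) * (size T + 2 * R)            ≤⟨ *-mono-≤ (min x ≤-refl) (+-monoʳ-≤ (size T) (*-monoʳ-≤ 2 R≤X)) ⟩
      W X * (R * R) * (size T + 2 * X)            ≡⟨ lem₃ (W X) R _ ⟩
      W X * (size T + 2 * X) * (R * R)            ∎)
      where
      open ≤-Reasoning
      R = suc q
      lem₁ : ∀ X Y R → X * X * Y * (R * R) ≡ X * X * (R * R * Y)
      lem₁ = solve-∀
      lem₂ : ∀ X W a → X * X * (W * a) ≡ W * (X * X) * a
      lem₂ = solve-∀
      lem₃ : ∀ W R a → W * (R * R) * a ≡ W * a * (R * R)
      lem₃ = solve-∀

-- A cheap integral cover of one tree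

module _ {V : Set} {E : V → V → Set} {r v : V} (e : E r v) (G : Forest {E = E} v)
  (D L : ℕ) ⦃ _ : NonZero D ⦄ ⦃ _ : NonZero L ⦄ where

  private
    T : Forest {E = E} r
    T = cons v e G ∅

    Ball : Set
    Ball = Pos T × Fin D

    radius : Ball → ℕ
    radius (_ , j) = suc (toℕ j) * L

    _∋_ : Ball → Pos T → Set
    b ∋ x = dist (proj₁ b) x ≤ radius b

    _∋?_ : ∀ b x → Dec (b ∋ x)
    b ∋? x = dist (proj₁ b) x ≤? radius b

    balls : List Ball
    balls = cartesianProduct (positions T) (allFin D)

    ∈-balls : ∀ b → b ∈ balls
    ∈-balls (p , j) = ∈-cartesianProduct⁺ (∈-positions p) (∈-allFin j)

    -- Flipped to list the deepest points first: `nested` compares balls through `x` on points no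
    -- deeper than `x`.
    order = On.decTotalOrder (Flip.decTotalOrder ≤-decTotalOrder) (dep {F = T})

    points : List (Pos T)
    points = sort order (positions T)

    ∈-points : ∀ p → p ∈ points
    ∈-points p = ∈-resp-↭ (↭-sym (sort-↭ order (positions T))) (∈-positions p)

    nested-balls : (xs : List (Pos T)) → AllPairs (λ x z → dep z ≤ dep x) xs → Nested _∋_ _∋?_ xs
    nested-balls []       []         = tt
    nested-balls (x ∷ xs) (x≥ ∷ xs≥) = comparable , nested-balls xs xs≥
      where
      comparable : ∀ b c → b ∋ x → c ∋ x → (∀ z → z ∈ xs → b ∋ z → c ∋ z) ⊎ (∀ z → z ∈ xs → c ∋ z → b ∋ z)
      comparable b@(p , _) c@(q , _) b∋x c∋x with ≤-total (radius b + dep q) (radius c + dep p)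
      ... | inj₁ b≤c = inj₁ (λ z z∈ → nested p q x z b≤c (All.lookup x≥ z∈) b∋x c∋x)
      ... | inj₂ c≤b = inj₂ (λ z z∈ → nested q p x z c≤b (All.lookup x≥ z∈) c∋x b∋x)

  -- Let `w` record the largest masses of balls in the dual weighting. It is monotone whatever `P`
  -- is, and at most `P j` on the block of radii above j L up to (j + 1) L. So its first D L values
  -- sum to at most L times the sum of the prices, and `X²Y≤` is applied at X = D L.
  cheap-cover : (P : ℕ → ℕ) → ∃ λ (C : List (Pos T × Fin D)) →
    (∀ x → Any.Any (λ (p , j) → dist p x ≤ suc (toℕ j) * L) C) ×
    D * D * L * ∑ C (λ (_ , j) → P (toℕ j)) ≤ (size T + 2 * (D * L)) * ∑ (downFrom D) P
  cheap-cover P with duality _∋_ _∋?_ balls points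
                       (nested-balls points (Sorted⇒AllPairs (DecTotalOrder.totalOrder order) (sort-↗ order (positions T))))
                       (λ x _ → lose (∈-balls (x , Fin.fromℕ< (>-nonZero⁻¹ D))) (≤-trans (≤-reflexive (dist-refl x)) z≤n))
                       (λ (_ , j) → P (toℕ j))
  ... | ys , C , load≤ , covers , cost = C , (λ x → covers x (∈-points x)) , *-cancelˡ-≤ L (begin
      L * (D * D * L * ∑ C (λ (_ , j) → P (toℕ j)))       ≤⟨ *-monoʳ-≤ L (*-monoʳ-≤ (D * D * L) cost) ⟩
      L * (D * D * L * ∑ ys proj₂)                        ≡⟨ lem₁ D L (∑ ys proj₂) ⟩
      D * L * (D * L) * ∑ ys proj₂                        ≤⟨ X²Y≤ e G ys w w-mono mass≤w (D * L) ⟩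
      ∑ (downFrom (D * L)) w * (size T + 2 * (D * L))     ≤⟨ *-monoˡ-≤ (size T + 2 * (D * L)) (W≤ D ≤-refl) ⟩
      L * ∑ (downFrom D) P * (size T + 2 * (D * L))       ≡⟨ lem₂ L (∑ (downFrom D) P) (size T + 2 * (D * L)) ⟩
      L * ((size T + 2 * (D * L)) * ∑ (downFrom D) P)     ∎)
    where
    open ≤-Reasoning
    lem₁ : ∀ D L Y → L * (D * D * L * Y) ≡ D * L * (D * L) * Y
    lem₁ = solve-∀
    lem₂ : ∀ a b c → a * b * c ≡ a * (c * b)
    lem₂ = solve-∀
    w : ℕ → ℕ
    w i = maximum (positions T) (λ p → mass e G ys p (suc i))
    w-mono : ∀ {i j} → i ≤ j → w i ≤ w j
    w-mono i≤j = maximum-mono (positions T) (λ p → mass-mono e G ys p (s≤s i≤j))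
    mass≤w : ∀ p i → mass e G ys p (suc i) ≤ w i
    mass≤w p i = f≤maximum (λ p → mass e G ys p (suc i)) (∈-positions p)
    mass≤P : ∀ p j → j < D → mass e G ys p (suc j * L) ≤ P j
    mass≤P p j j<D = subst (λ i → mass e G ys p (suc i * L) ≤ P i) (Fin.toℕ-fromℕ< j<D)
      (load≤ (p , Fin.fromℕ< j<D) (∈-balls _))
    W≤ : ∀ j → j ≤ D → ∑ (downFrom (j * L)) w ≤ L * ∑ (downFrom j) P
    W≤ zero    _   = z≤n
    W≤ (suc j) j<D = begin
      ∑ (downFrom (L + j * L)) w                   ≤⟨ ∑-below w L w≤P ⟩
      L * P j + ∑ (downFrom (j * L)) w             ≤⟨ +-monoʳ-≤ (L * P j) (W≤ j (<⇒≤ j<D)) ⟩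
      L * P j + L * ∑ (downFrom j) P               ≡⟨ *-distribˡ-+ L (P j) _ ⟨
      L * ∑ (downFrom (suc j)) P                   ∎
      where
      w≤P : ∀ t → t < L → w (t + j * L) ≤ P j
      w≤P t t<L = maximum≤ (positions T) (λ p →
        ≤-trans (mass-mono e G ys p (+-monoˡ-≤ (j * L) t<L)) (mass≤P p j j<D))

-- Graph distances and spanning trees

lookup-injective : {A : Set} {us : List A} → Unique us → ∀ i j → lookup us i ≡ lookup us j → i ≡ j
lookup-injective (u∉ ∷ _) Fin.zero    Fin.zero    _  = refl
lookup-injective (u∉ ∷ _) Fin.zero    (Fin.suc j) eq = ⊥-elim (All.lookup u∉ (∈-lookup j) eq)
lookup-injective (u∉ ∷ _) (Fin.suc i) Fin.zero    eq = ⊥-elim (All.lookup u∉ (∈-lookup i) (sym eq))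
lookup-injective (_ ∷ us) (Fin.suc i) (Fin.suc j) eq = cong Fin.suc (lookup-injective us i j eq)

Unique⇒length≤ : ∀ {n} {us : List (Fin n)} → Unique us → length us ≤ n
Unique⇒length≤ {us = us} unique = Fin.injective⇒≤ {f = lookup us} (λ {i} {j} → lookup-injective unique i j)

module _ {n : ℕ} (G : Graph n) where

  -- Within radius 1 rather than adjacent: then a piece with root v is itself a forest below v.
  Edge : Fin n → Fin n → Set
  Edge u v = Within G u v 1

  Tree : Fin n → Set
  Tree = Forest {E = Edge}

  within-mono : ∀ {u v r s} → r ≤ s → Within G u v r → Within G u v s
  within-mono r≤s       here         = here
  within-mono (s≤s r≤s) (step a w) = step a (within-mono r≤s w)

  within-trans : ∀ {u v w r s} → Within G u v r → Within G v w s → Within G u w (r + s)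
  within-trans {r = r} {s} here w′ = within-mono (m≤n+m s r) w′
  within-trans (step a w) w′       = step a (within-trans w w′)

  within-sym : ∀ {u v r} → Within G u v r → Within G v u r
  within-sym here = here
  within-sym {r = suc r} (step {u} {v} a w) =
    subst (Within G _ _) (+-comm r 1) (within-trans (within-sym w) (step (Graph.sym G u v a) here))

  private variable
    r : Fin n
    F : Tree r

  within-root : {F : Tree r} (p : Pos F) → Within G r (label p) (suc (dep p))
  within-root (top {e = e})    = e
  within-root (down {e = e} p) = within-trans e (within-root p)
  within-root (next p)         = within-root p

  within-dist : (p q : Pos F) → Within G (label p) (label q) (dist p q)
  within-dist top top = here
  within-dist top (down q) = within-root q
  within-dist (top {e = e}) (next q) = within-trans (within-sym e) (within-root q)
  within-dist (down p) top = within-sym (within-root p)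
  within-dist (down p) (down q) = within-dist p q
  within-dist (down {e = e} p) (next q) = subst (Within G _ _) (lem (dep p) (dep q))
    (within-trans (within-sym (within-trans e (within-root p))) (within-root q))
    where
    lem : ∀ a b → 1 + (1 + a) + (1 + b) ≡ 3 + (b + a)
    lem = solve-∀
  within-dist (next {e = e} p) top = subst (Within G _ _) (+-comm (suc (dep p)) 1)
    (within-trans (within-sym (within-root p)) e)
  within-dist (next p) (down {e = e} q) = subst (Within G _ _) (lem (dep p) (dep q))
    (within-trans (within-sym (within-root p)) (within-trans e (within-root q)))
    where
    lem : ∀ a b → 1 + a + (1 + (1 + b)) ≡ 3 + (b + a)
    lem = solve-∀
  within-dist (next p) (next q) = within-dist p q

  Has : Tree r → Fin n → Set
  Has F u = ∃ λ (p : Pos F) → label p ≡ u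

  attach : (F : Tree r) (p : Pos F) {w : Fin n} → Edge (label p) w → Tree r
  attach (cons v e c s) top      {w} e′ = cons v e (cons w e′ ∅ c) s
  attach (cons v e c s) (down p)     e′ = cons v e (attach c p e′) s
  attach (cons v e c s) (next p)     e′ = cons v e c (attach s p e′)

  size-attach : (F : Tree r) (p : Pos F) {w : Fin n} (e : Edge (label p) w) → size (attach F p e) ≡ suc (size F)
  size-attach (cons v e c s) top      e′ = refl
  size-attach (cons v e c s) (down p) e′ = cong (λ i → suc (i + size s)) (size-attach c p e′)
  size-attach (cons v e c s) (next p) e′ =
    cong suc (trans (cong (size c +_) (size-attach s p e′)) (+-suc (size c) (size s)))

  attach-new : (F : Tree r) (p : Pos F) {w : Fin n} (e : Edge (label p) w) → Has (attach F p e) w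
  attach-new (cons v e c s) top      e′ = down top , refl
  attach-new (cons v e c s) (down p) e′ with attach-new c p e′
  ... | q , eq = down q , eq
  attach-new (cons v e c s) (next p) e′ with attach-new s p e′
  ... | q , eq = next q , eq

  attach-old : (F : Tree r) (p : Pos F) {w : Fin n} (e : Edge (label p) w) (q : Pos F) →
               Has (attach F p e) (label q)
  attach-old (cons v e c s) top      e′ top      = top , refl
  attach-old (cons v e c s) top      e′ (down q) = down (next q) , refl
  attach-old (cons v e c s) top      e′ (next q) = next q , refl
  attach-old (cons v e c s) (down p) e′ top      = top , refl
  attach-old (cons v e c s) (down p) e′ (down q) with attach-old c p e′ q
  ... | q′ , eq = down q′ , eq
  attach-old (cons v e c s) (down p) e′ (next q) = next q , refl
  attach-old (cons v e c s) (next p) e′ top      = top , refl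
  attach-old (cons v e c s) (next p) e′ (down q) = down q , refl
  attach-old (cons v e c s) (next p) e′ (next q) with attach-old s p e′ q
  ... | q′ , eq = next q′ , eq

  open DecPropositional (Fin._≟_ {n}) using (_∈?_)

  exit-edge : (us : List (Fin n)) → ∀ {u v k} → Within G u v k → u ∈ us → v ∉ us →
              ∃ λ a → ∃ λ b → a ∈ us × b ∉ us × adj G a b ≡ true
  exit-edge us here u∈ v∉ = ⊥-elim (v∉ u∈)
  exit-edge us (step {u} {v} a w) u∈ v∉ with v ∈? us
  ... | yes v∈ = exit-edge us w v∈ v∉
  ... | no v∉′ = u , v , u∈ , v∉′ , a

  -- The fuel `m` bounds the number of vertices still missing: a new vertex when it is 0 would give
  -- more than `n` distinct ones.
  spanning-tree-from : Connected G → (m : ℕ) (us : List (Fin n)) → Unique us → r ∈ us → n ≤ length us + m →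
    (F : Tree r) → size F ≤ length us → (∀ u → u ∈ us → Has F u) → ∃ λ (F : Tree r) → size F ≤ n × (∀ u → Has F u)
  spanning-tree-from {r} conn m us unique r∈ n≤ F small has with Fin.all? (_∈? us)
  ... | yes all = F , ≤-trans small (Unique⇒length≤ unique) , λ u → has u (all u)
  ... | no ¬all with Fin.¬∀⟶∃¬ n _ (_∈? us) ¬all
  ...   | u , u∉ with exit-edge us (proj₂ (conn r u)) r∈ u∉
  ...     | a , b , a∈ , b∉ , adj-ab with has a a∈ | m
  ...       | p , refl | zero  = ⊥-elim (<⇒≱ (Unique⇒length≤ b∷us-unique) (subst (n ≤_) (+-identityʳ (length us)) n≤))
    where
    b∷us-unique : Unique (b ∷ us)
    b∷us-unique = All.tabulate (λ { x∈ refl → b∉ x∈ }) ∷ unique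
  ...       | p , refl | suc m = spanning-tree-from conn m (b ∷ us) b∷us-unique (there r∈)
      (subst (n ≤_) (+-suc (length us) m) n≤)
      (attach F p edge) (≤-trans (≤-reflexive (size-attach F p edge)) (s≤s small)) has′
    where
    edge : Edge (label p) b
    edge = step adj-ab here
    b∷us-unique : Unique (b ∷ us)
    b∷us-unique = All.tabulate (λ { x∈ refl → b∉ x∈ }) ∷ unique
    has′ : ∀ u → u ∈ b ∷ us → Has (attach F p edge) u
    has′ u (here refl) = attach-new F p edge
    has′ u (there u∈) with has u u∈
    ... | q , refl = attach-old F p edge q

  spanning-tree : Connected G → (r : Fin n) → ∃ λ (F : Tree r) → size F ≤ n × (∀ u → Has F u)
  spanning-tree conn r = spanning-tree-from conn n (r ∷ []) ([] ∷ []) (here refl) (n≤1+n n)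
    (cons r here ∅ ∅) ≤-refl λ where _ (here refl) → top , refl

  -- Cutting a tree into pieces

  -- A forest without its root vertex: several pieces may hang below the same root, which `rooted`
  -- puts back when a piece is covered.
  Piece : Set
  Piece = ∃ Tree

  module _ (M : ℕ) where

    record Cut (bound : ℕ) (F : Tree r) : Set where
      field
        pieces  : List Piece
        rest    : Tree r
        rest<   : size rest < bound
        large   : All (λ (_ , H) → M ≤ size H) pieces
        small   : All (λ (_ , H) → size H < 2 * M) pieces
        total   : ∑ pieces (λ (_ , H) → size H) + size rest ≡ size F
        located : ∀ u → Has F u → Any.Any (λ (_ , H) → Has H u) pieces ⊎ Has rest u

    join : ∀ {v} (e : Edge r v) {c s} → Cut M c → Cut M s → Cut (2 * M) (cons v e c s)
    join {v = v} e {c} {s} C S = record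
      { pieces  = C.pieces ++ S.pieces
      ; rest    = cons v e C.rest S.rest
      ; rest<   = rest<
      ; large   = All.++⁺ C.large S.large
      ; small   = All.++⁺ C.small S.small
      ; total   = trans (cong (_+ suc (size C.rest + size S.rest)) (∑-++ C.pieces S.pieces _))
          (trans (lem (∑ C.pieces (λ (_ , H) → size H)) (∑ S.pieces (λ (_ , H) → size H)) (size C.rest) (size S.rest))
            (cong₂ (λ i j → suc (i + j)) C.total S.total))
      ; located = located
      }
      where
      module C = Cut C
      module S = Cut S
      lem : ∀ a b c s → a + b + (1 + (c + s)) ≡ 1 + (a + c + (b + s))
      lem = solve-∀
      rest< : suc (suc (size C.rest + size S.rest)) ≤ 2 * M
      rest< = subst₂ _≤_ (cong suc (+-suc (size C.rest) (size S.rest))) (cong (M +_) (sym (+-identityʳ M)))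
        (+-mono-≤ C.rest< S.rest<)
      located : ∀ u → Has (cons v e c s) u →
                Any.Any (λ (_ , H) → Has H u) (C.pieces ++ S.pieces) ⊎ Has (cons v e C.rest S.rest) u
      located u (top , eq) = inj₂ (top , eq)
      located u (down p , eq) with C.located u (p , eq)
      ... | inj₁ found     = inj₁ (Any.++⁺ˡ found)
      ... | inj₂ (q , eq′) = inj₂ (down q , eq′)
      located u (next p , eq) with S.located u (p , eq)
      ... | inj₁ found     = inj₁ (Any.++⁺ʳ C.pieces found)
      ... | inj₂ (q , eq′) = inj₂ (next q , eq′)

    close : 0 < M → {F : Tree r} → Cut (2 * M) F → Cut M F
    close {r} 0<M C with <-≤-connex (size (Cut.rest C)) M
    ... | inj₁ rest<M = record { Cut C hiding (rest<) ; rest< = rest<M }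
    ... | inj₂ M≤rest = record
      { pieces  = (r , rest) ∷ pieces
      ; rest    = ∅
      ; rest<   = 0<M
      ; large   = M≤rest ∷ large
      ; small   = rest< ∷ small
      ; total   = trans (+-identityʳ _) (trans (+-comm (size rest) _) total)
      ; located = λ u has → inj₁ (Sum.[ there , here ] (located u has))
      }
      where open Cut C

    -- Vertices are passed on to the parent until at least M of them hang below it.
    cut : 0 < M → (F : Tree r) → Cut M F
    cut 0<M ∅ = record
      { pieces = [] ; rest = ∅ ; rest< = 0<M ; large = [] ; small = [] ; total = refl ; located = λ _ → inj₂ }
    cut 0<M (cons v e c s) = close 0<M (join e (cut 0<M c) (cut 0<M s))

    large⇒few : (ps : List Piece) → All (λ (_ , H) → M ≤ size H) ps → length ps * M ≤ ∑ ps (λ (_ , H) → size H)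
    large⇒few ps large = ≤-trans (≤-reflexive (sym (∑-const ps M))) (∑-mono ps (λ _ p∈ → All.lookup large p∈))

    -- The rest left at the end becomes a piece as well, perhaps a small one; hence the additional
    -- `M` in the bound on their number.
    cut-tree : 0 < M → (F : Tree r) → ∃ λ (ps : List Piece) → length ps * M ≤ size F + M ×
               ∑ ps (λ (_ , H) → size H) ≡ size F × All (λ (_ , H) → size H < 2 * M) ps ×
               (∀ u → Has F u → Any.Any (λ (_ , H) → Has H u) ps)
    cut-tree {r} 0<M F = (r , rest) ∷ pieces ,
      ≤-trans (+-monoʳ-≤ M (≤-trans (large⇒few pieces large) (≤-trans (m≤m+n _ (size rest)) (≤-reflexive total))))
        (≤-reflexive (+-comm M (size F))) ,
      trans (+-comm (size rest) _) total ,
      <-≤-trans rest< (m≤m+n M (M + 0)) ∷ small ,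
      λ u has → Sum.[ there , here ] (located u has)
      where open Cut (cut 0<M F)

-- The quadratic potential

∑-pick≤ : (P : ℕ → ℕ) (i D : ℕ) → ∑ (downFrom D) (λ j → P j * 𝟙 (i ≟ j)) ≤ P i
∑-pick≤ P i zero    = z≤n
∑-pick≤ P i (suc D) with i ≟ D
... | no _     = ≤-trans (≤-reflexive (cong (_+ ∑ (downFrom D) (λ j → P j * 𝟙 (i ≟ j))) (*-zeroʳ (P D)))) (∑-pick≤ P i D)
... | yes refl = begin
  P D * 1 + ∑ (downFrom D) (λ j → P j * 𝟙 (D ≟ j))      ≤⟨ +-mono-≤ (≤-reflexive (*-identityʳ (P D))) (∑-mono (downFrom D) absent) ⟩
  P D + ∑ (downFrom D) (λ _ → 0)                        ≡⟨ cong (P D +_) (trans (∑-const (downFrom D) 0) (*-zeroʳ (length (downFrom D)))) ⟩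
  P D + 0                                               ≡⟨ +-identityʳ (P D) ⟩
  P D                                                   ∎
  where
  open ≤-Reasoning
  absent : ∀ j → j ∈ downFrom D → P j * 𝟙 (D ≟ j) ≤ 0
  absent j j∈ = ≤-reflexive (trans (cong (P j *_) (𝟙-no (D ≟ j) (λ D≡j → <-irrefl (sym D≡j) (∈-downFrom⁻ j∈)))) (*-zeroʳ (P j)))

length-filter-𝟙 : {A : Set} {P : A → Set} (P? : ∀ x → Dec (P x)) (xs : List A) →
                  length (filter P? xs) ≡ ∑ xs (λ x → 𝟙 (P? x))
length-filter-𝟙 P? []       = refl
length-filter-𝟙 P? (x ∷ xs) with P? x
... | yes _ = cong suc (length-filter-𝟙 P? xs)
... | no _  = length-filter-𝟙 P? xs

-- One term of the quadratic potential: X is the current excess, a its increase, s the budget gained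
-- and X + B the price.
potential-step : ∀ X a s B → (X + a ∸ s) * (X + a ∸ s) + 2 * ((X + B) * s) ≤
                 X * X + 2 * ((X + B) * a) + (2 * B * s + (a * a + s * s))
potential-step X a s B with ≤-total s (X + a)
... | inj₁ s≤ = begin
  Y * Y + 2 * ((X + B) * s)                                     ≤⟨ +-monoʳ-≤ (Y * Y) (*-monoʳ-≤ 2 (*-monoˡ-≤ s (+-monoˡ-≤ B X≤))) ⟩
  Y * Y + 2 * ((Y + s + B) * s)                                 ≡⟨ lem₁ Y s B ⟩
  (Y + s) * (Y + s) + (2 * B * s + s * s)                       ≡⟨ cong (λ i → i * i + (2 * B * s + s * s)) (m∸n+n≡m s≤) ⟩
  (X + a) * (X + a) + (2 * B * s + s * s)                       ≤⟨ m≤m+n _ (2 * B * a) ⟩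
  (X + a) * (X + a) + (2 * B * s + s * s) + 2 * B * a           ≡⟨ lem₂ X a s B ⟩
  X * X + 2 * ((X + B) * a) + (2 * B * s + (a * a + s * s))     ∎
  where
  open ≤-Reasoning
  Y = X + a ∸ s
  X≤ : X ≤ Y + s
  X≤ = ≤-trans (m≤m+n X a) (≤-reflexive (sym (m∸n+n≡m s≤)))
  lem₁ : ∀ Y s B → Y * Y + 2 * ((Y + s + B) * s) ≡ (Y + s) * (Y + s) + (2 * B * s + s * s)
  lem₁ = solve-∀
  lem₂ : ∀ X a s B → (X + a) * (X + a) + (2 * B * s + s * s) + 2 * B * a ≡
         X * X + 2 * ((X + B) * a) + (2 * B * s + (a * a + s * s))
  lem₂ = solve-∀
... | inj₂ ≤s = begin
  (X + a ∸ s) * (X + a ∸ s) + 2 * ((X + B) * s)                 ≡⟨ cong₂ (λ i j → i * i + 2 * ((X + B) * j)) (m≤n⇒m∸n≡0 ≤s) (sym (m+[n∸m]≡n X≤s)) ⟩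
  2 * ((X + B) * (X + t))                                       ≤⟨ m≤m+n _ (t * t + 2 * ((X + B) * a) + a * a) ⟩
  2 * ((X + B) * (X + t)) + (t * t + 2 * ((X + B) * a) + a * a)
                                                                ≡⟨ lem X a t B ⟩
  X * X + 2 * ((X + B) * a) + (2 * B * (X + t) + (a * a + (X + t) * (X + t)))
                                                                ≡⟨ cong (λ j → X * X + 2 * ((X + B) * a) + (2 * B * j + (a * a + j * j))) (m+[n∸m]≡n X≤s) ⟩
  X * X + 2 * ((X + B) * a) + (2 * B * s + (a * a + s * s))     ∎
  where
  open ≤-Reasoning
  X≤s : X ≤ s
  X≤s = ≤-trans (m≤m+n X a) ≤s
  t = s ∸ X
  lem : ∀ X a t B → 2 * ((X + B) * (X + t)) + (t * t + 2 * ((X + B) * a) + a * a) ≡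
        X * X + 2 * ((X + B) * a) + (2 * B * (X + t) + (a * a + (X + t) * (X + t)))
  lem = solve-∀

square-cancel-≤ : ∀ {a b} → a * a ≤ b * b → a ≤ b
square-cancel-≤ {a} {b} a²≤b² = ≮⇒≥ (λ b<a → <⇒≱ (*-mono-< b<a b<a) a²≤b²)

-- The hypothesis says that at prices X + B the increases a cost at most as much as the budget s.
module _ (js : List ℕ) (X a : ℕ → ℕ) (B s : ℕ)
         (affordable : ∑ js (λ j → (X j + B) * a j) ≤ s * ∑ js (λ j → X j + B)) where

  -- On summing `potential-step`, `affordable` bounds the first-order cost of the increases by that
  -- of the budget. What remains is the share 2 B s of the base price and the squares.
  potential-sum : ∑ js (λ j → (X j + a j ∸ s) * (X j + a j ∸ s)) ≤
                  ∑ js (λ j → X j * X j) + (length js * (2 * B * s) + ∑ js (λ j → a j * a j + s * s))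
  potential-sum = +-cancelʳ-≤ (2 * (s * ∑ js (λ j → X j + B))) _ _ (begin
    ∑ js X′² + 2 * (s * ∑ js (λ j → X j + B))
      ≡⟨ cong (∑ js X′² +_) (trans (∑-* 2 js _) (cong (2 *_) (trans (∑-cong js (λ j → *-comm (X j + B) s)) (∑-* s js _)))) ⟨
    ∑ js X′² + ∑ js (λ j → 2 * ((X j + B) * s))
      ≡⟨ ∑-+ js _ _ ⟨
    ∑ js (λ j → X′² j + 2 * ((X j + B) * s))
      ≤⟨ ∑-mono js (λ j _ → potential-step (X j) (a j) s B) ⟩
    ∑ js (λ j → X j * X j + 2 * ((X j + B) * a j) + (2 * B * s + (a j * a j + s * s)))
      ≡⟨ trans (∑-+ js _ _) (cong₂ _+_ (∑-+ js _ _) (∑-+ js _ _)) ⟩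
    ∑ js (λ j → X j * X j) + ∑ js (λ j → 2 * ((X j + B) * a j)) + (∑ js (λ _ → 2 * B * s) + Q)
      ≡⟨ cong₂ (λ u t → ∑ js (λ j → X j * X j) + u + (t + Q)) (∑-* 2 js _) (∑-const js (2 * B * s)) ⟩
    ∑ js (λ j → X j * X j) + 2 * ∑ js (λ j → (X j + B) * a j) + (length js * (2 * B * s) + Q)
      ≤⟨ +-monoˡ-≤ (length js * (2 * B * s) + Q) (+-monoʳ-≤ (∑ js (λ j → X j * X j)) (*-monoʳ-≤ 2 affordable)) ⟩
    ∑ js (λ j → X j * X j) + 2 * (s * ∑ js (λ j → X j + B)) + (length js * (2 * B * s) + Q)
      ≡⟨ lem (∑ js (λ j → X j * X j)) (2 * (s * ∑ js (λ j → X j + B))) (length js * (2 * B * s) + Q) ⟩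
    ∑ js (λ j → X j * X j) + (length js * (2 * B * s) + Q) + 2 * (s * ∑ js (λ j → X j + B)) ∎)
    where
    open ≤-Reasoning
    X′² : ℕ → ℕ
    X′² j = (X j + a j ∸ s) * (X j + a j ∸ s)
    Q = ∑ js (λ j → a j * a j + s * s)
    lem : ∀ x y z → x + y + z ≡ x + z + y
    lem = solve-∀

  -- This is the purpose of the base price: one class can spend at most the whole budget, each unit
  -- costs at least `B`, and the potential keeps all prices within (q + 1) B. As `B` cancels,
  -- enlarging it does not enlarge the second-order terms.
  increase≤ : ⦃ _ : NonZero B ⦄ (q : ℕ) → ∑ js (λ j → X j * X j) ≤ q * B * (q * B) →
              ∀ j → j ∈ js → a j ≤ s * (length js * suc q)
  increase≤ q X²≤ j j∈ = *-cancelˡ-≤ B (begin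
    B * a j                                 ≤⟨ *-monoˡ-≤ (a j) (m≤n+m B (X j)) ⟩
    (X j + B) * a j                         ≤⟨ ∑-term (λ j → (X j + B) * a j) j∈ ⟩
    ∑ js (λ j → (X j + B) * a j)            ≤⟨ affordable ⟩
    s * ∑ js (λ j → X j + B)                ≤⟨ *-monoʳ-≤ s (∑-mono js (λ j j∈ → +-monoˡ-≤ B (X≤ j j∈))) ⟩
    s * ∑ js (λ _ → q * B + B)              ≡⟨ cong (s *_) (∑-const js (q * B + B)) ⟩
    s * (length js * (q * B + B))           ≡⟨ lem s (length js) q B ⟩
    B * (s * (length js * suc q))           ∎)
    where
    open ≤-Reasoning
    X≤ : ∀ j → j ∈ js → X j ≤ q * B
    X≤ j j∈ = square-cancel-≤ (≤-trans (∑-term (λ j → X j * X j) j∈) X²≤)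
    lem : ∀ s d q B → s * (d * (q * B + B)) ≡ B * (s * (d * (1 + q)))
    lem = solve-∀

  potential-sum≤ : ⦃ _ : NonZero B ⦄ (q m : ℕ) → ∑ js (λ j → X j * X j) ≤ q * B * (q * B) → s ≤ m →
    ∑ js (λ j → (X j + a j ∸ s) * (X j + a j ∸ s)) ≤ ∑ js (λ j → X j * X j) +
    (length js * (2 * B * s) + length js * (m * (length js * suc q) * (m * (length js * suc q)) + m * m))
  potential-sum≤ q m X²≤ s≤m = ≤-trans potential-sum
    (+-monoʳ-≤ (∑ js (λ j → X j * X j)) (+-monoʳ-≤ (length js * (2 * B * s))
      (≤-trans (∑-mono js (λ j j∈ → +-mono-≤ (*-mono-≤ (a≤ j j∈) (a≤ j j∈)) (*-mono-≤ s≤m s≤m)))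
               (≤-reflexive (∑-const js _)))))
    where
    a≤ : ∀ j → j ∈ js → a j ≤ m * (length js * suc q)
    a≤ j j∈ = ≤-trans (increase≤ q X²≤ j j∈) (*-monoˡ-≤ (length js * suc q) s≤m)

-- Covering the pieces one after another

module _ {n : ℕ} (G : Graph n) (D L : ℕ) ⦃ _ : NonZero D ⦄ ⦃ _ : NonZero L ⦄ where

  private
    Z = D * D * L

  Centres : Set
  Centres = ℕ → List (Fin n)

  Served : Centres → Fin n → Set
  Served cs u = ∃ λ j → j < D × ∃ λ c → c ∈ cs j × Within G u c (suc j * L)

  rooted : {v : Fin n} → Tree G v → Tree G v
  rooted {v} H = cons v here H ∅

  -- The factor in `cheap-cover`; divided by `Z`, it is the number of further centres that the piece
  -- grants to each class.
  cost : Piece G → ℕ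
  cost (_ , H) = size (rooted H) + 2 * (D * L)

  module _ (P : ℕ → ℕ) {v : Fin n} (H : Tree G v) where

    private
      Ball : Set
      Ball = Pos (rooted H) × Fin D

      class? : ∀ j (b : Ball) → Dec (toℕ (proj₂ b) ≡ j)
      class? j (_ , i) = toℕ i ≟ j

      centres : List Ball → Centres
      centres C j = map (λ (p , _) → label p) (filter (class? j) C)

      count : ∀ C j → P j * length (centres C j) ≡ ∑ C (λ (_ , i) → P j * 𝟙 (toℕ i ≟ j))
      count C j = trans (cong (P j *_) (trans (length-map _ (filter (class? j) C)) (length-filter-𝟙 (class? j) C)))
        (sym (∑-* (P j) C _))

      price≤ : ∀ C → ∑ (downFrom D) (λ j → P j * length (centres C j)) ≤ ∑ C (λ (_ , i) → P (toℕ i))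
      price≤ C = begin
        ∑ (downFrom D) (λ j → P j * length (centres C j))
          ≡⟨ ∑-cong (downFrom D) (count C) ⟩
        ∑ (downFrom D) (λ j → ∑ C (λ (_ , i) → P j * 𝟙 (toℕ i ≟ j)))
          ≡⟨ ∑-swap (downFrom D) C (λ j (_ , i) → P j * 𝟙 (toℕ i ≟ j)) ⟩
        ∑ C (λ (_ , i) → ∑ (downFrom D) (λ j → P j * 𝟙 (toℕ i ≟ j)))
          ≤⟨ ∑-mono C (λ (_ , i) _ → ∑-pick≤ P (toℕ i) D) ⟩
        ∑ C (λ (_ , i) → P (toℕ i)) ∎
        where open ≤-Reasoning

      served : ∀ C → (∀ x → Any.Any (λ (p , j) → dist p x ≤ suc (toℕ j) * L) C) → ∀ u → Has G H u → Served (centres C) u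
      served C covers u (x , refl) = from (find (covers (down x)))
        where
        from : (∃ λ ((p , j) : Ball) → (p , j) ∈ C × dist p (down x) ≤ suc (toℕ j) * L) → Served (centres C) (label x)
        from ((p , i) , b∈ , d≤) = toℕ i , Fin.toℕ<n i , label p ,
          ∈-map⁺ (λ (p , _) → label p) (∈-filter⁺ (class? (toℕ i)) b∈ refl) ,
          within-mono G d≤ (within-sym G (within-dist G p (down x)))

    serve : ∃ λ (cs : Centres) → (∀ u → Has G H u → Served cs u) ×
            Z * ∑ (downFrom D) (λ j → P j * length (cs j)) ≤ cost (v , H) * ∑ (downFrom D) P
    serve = from (cheap-cover here H D L P)
      where
      from : (∃ λ (C : List Ball) → (∀ x → Any.Any (λ (p , j) → dist p x ≤ suc (toℕ j) * L) C) ×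
               Z * ∑ C (λ (_ , j) → P (toℕ j)) ≤ cost (v , H) * ∑ (downFrom D) P) → _
      from (C , covers , cheap) = centres C , served C covers , ≤-trans (*-monoʳ-≤ Z (price≤ C)) cheap

  -- After pieces of total cost `S`, each class is entitled to S / Z centres; scaling by `Z` avoids
  -- the fraction.
  excess : Centres → ℕ → ℕ → ℕ
  excess cs S j = Z * length (cs j) ∸ S

  potential : Centres → ℕ → ℕ
  potential cs S = ∑ (downFrom D) (λ j → excess cs S j * excess cs S j)

  _⊕_ : Centres → Centres → Centres
  (new ⊕ cs) j = new j ++ cs j

  excess-⊕ : ∀ new cs s S j → excess (new ⊕ cs) (s + S) j ≤ excess cs S j + Z * length (new j) ∸ s
  excess-⊕ new cs s S j = begin
    Z * length (new j ++ cs j) ∸ (s + S)                   ≡⟨ cong (λ i → Z * i ∸ (s + S)) (length-++ (new j)) ⟩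
    Z * (length (new j) + length (cs j)) ∸ (s + S)         ≡⟨ cong (_∸ (s + S)) (*-distribˡ-+ Z (length (new j)) _) ⟩
    a + Z * length (cs j) ∸ (s + S)                        ≤⟨ ∸-monoˡ-≤ (s + S) (+-monoʳ-≤ a (m≤n+m∸n (Z * length (cs j)) S)) ⟩
    a + (S + excess cs S j) ∸ (s + S)                      ≡⟨ cong₂ _∸_ (lem a S (excess cs S j)) (+-comm s S) ⟩
    S + (excess cs S j + a) ∸ (S + s)                      ≡⟨ [m+n]∸[m+o]≡n∸o S (excess cs S j + a) s ⟩
    excess cs S j + a ∸ s                                  ∎
    where
    open ≤-Reasoning
    a = Z * length (new j)
    lem : ∀ a S x → a + (S + x) ≡ S + (x + a)
    lem = solve-∀

  module _ (B q m : ℕ) ⦃ _ : NonZero B ⦄ where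

    -- The second-order terms for one piece of cost at most `m`, with the increases bounded by
    -- `increase≤`.
    drift : ℕ
    drift = D * (m * (D * suc q) * (m * (D * suc q)) + m * m)

    potential-⊕ : ∀ new cs s S → s ≤ m → potential cs S ≤ q * B * (q * B) →
      Z * ∑ (downFrom D) (λ j → (excess cs S j + B) * length (new j)) ≤ s * ∑ (downFrom D) (λ j → excess cs S j + B) →
      potential (new ⊕ cs) (s + S) ≤ potential cs S + (D * (2 * B * s) + drift)
    potential-⊕ new cs s S s≤m pot≤ affordable = begin
      potential (new ⊕ cs) (s + S)
        ≤⟨ ∑-mono (downFrom D) (λ j _ → *-mono-≤ (excess-⊕ new cs s S j) (excess-⊕ new cs s S j)) ⟩
      ∑ (downFrom D) (λ j → (excess cs S j + Z * length (new j) ∸ s) * (excess cs S j + Z * length (new j) ∸ s))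
        ≤⟨ potential-sum≤ (downFrom D) (excess cs S) (λ j → Z * length (new j)) B s affordable′ q m pot≤ s≤m ⟩
      potential cs S + (length (downFrom D) * (2 * B * s) +
        length (downFrom D) * (m * (length (downFrom D) * suc q) * (m * (length (downFrom D) * suc q)) + m * m))
        ≡⟨ cong (λ i → potential cs S + (i * (2 * B * s) + i * (m * (i * suc q) * (m * (i * suc q)) + m * m))) (length-downFrom D) ⟩
      potential cs S + (D * (2 * B * s) + drift) ∎
      where
      open ≤-Reasoning
      lem : ∀ x z c → x * (z * c) ≡ z * (x * c)
      lem = solve-∀
      affordable′ : ∑ (downFrom D) (λ j → (excess cs S j + B) * (Z * length (new j))) ≤
                    s * ∑ (downFrom D) (λ j → excess cs S j + B)
      affordable′ = ≤-trans (≤-reflexive (trans (∑-cong (downFrom D) (λ j → lem (excess cs S j + B) Z (length (new j))))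
                                           (∑-* Z (downFrom D) _))) affordable

    Within-budget : List (Piece G) → Set
    Within-budget ps = 2 * D * B * ∑ ps cost + length ps * drift ≤ q * B * (q * B)

    -- A budget that holds for all pieces holds for every tail of the list, so before each piece the
    -- potential is below (q B)², as `increase≤` requires.
    distribute : (ps : List (Piece G)) → All (λ p → cost p ≤ m) ps → Within-budget ps → ∃ λ (cs : Centres) →
      (∀ u → Any.Any (λ (_ , H) → Has G H u) ps → Served cs u) ×
      potential cs (∑ ps cost) ≤ 2 * D * B * ∑ ps cost + length ps * drift
    distribute [] [] _ = (λ _ → []) , (λ _ ()) ,
      ≤-trans (∑-mono (downFrom D) (λ j _ → ≤-reflexive (cong (λ i → i * i) (*-zeroʳ Z))))
        (≤-trans (≤-reflexive (trans (∑-const (downFrom D) 0) (*-zeroʳ (length (downFrom D))))) z≤n)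
    distribute ((v , H) ∷ ps) (s≤m ∷ costs≤m) budget = extend (distribute ps costs≤m budget′)
      where
      s S : ℕ
      s = cost (v , H)
      S = ∑ ps cost
      budget′ : Within-budget ps
      budget′ = ≤-trans (+-mono-≤ (*-monoʳ-≤ (2 * D * B) (m≤n+m S s)) (m≤n+m _ drift)) budget
      lem : ∀ D B S p r s → 2 * D * B * S + p + (D * (2 * B * s) + r) ≡ 2 * D * B * (s + S) + (r + p)
      lem = solve-∀
      extend : _ → _
      extend (cs , served , pot≤) = add (serve (λ j → excess cs S j + B) H)
        where
        add : _ → _
        add (new , served′ , affordable) = new ⊕ cs , served″ , (begin
          potential (new ⊕ cs) (s + S)                              ≤⟨ potential-⊕ new cs s S s≤m (≤-trans pot≤ budget′) affordable ⟩
          potential cs S + (D * (2 * B * s) + drift)                ≤⟨ +-monoˡ-≤ (D * (2 * B * s) + drift) pot≤ ⟩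
          2 * D * B * S + length ps * drift + (D * (2 * B * s) + drift)
                                                                    ≡⟨ lem D B S (length ps * drift) drift s ⟩
          2 * D * B * (s + S) + suc (length ps) * drift             ∎)
          where
          open ≤-Reasoning
          served″ : ∀ u → Any.Any (λ (_ , H) → Has G H u) ((v , H) ∷ ps) → Served (new ⊕ cs) u
          served″ u (here has) with served′ u has
          ... | j , j<D , c , c∈ , within = j , j<D , c , ∈-++⁺ˡ c∈ , within
          served″ u (there found) with served u found
          ... | j , j<D , c , c∈ , within = j , j<D , c , ∈-++⁺ʳ (new j) c∈ , within

-- From centres to a burning sequence

nth : {A : Set} → A → List A → ℕ → A
nth z []       _       = z
nth z (x ∷ xs) zero    = x
nth z (x ∷ xs) (suc i) = nth z xs i

nth-∈ : {A : Set} (z : A) {xs : List A} {x : A} → x ∈ xs → ∃ λ i → i < length xs × nth z xs i ≡ x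
nth-∈ z (here refl) = 0 , s≤s z≤n , refl
nth-∈ z (there x∈) with nth-∈ z x∈
... | i , i< , eq = suc i , s≤s i< , eq

-- The centres of class j receive the radii (j + 1) L, ..., (j + 2) L - 1; the radii below L are wasted.
served⇒burns : ∀ {n} (G : Graph n) (D L : ℕ) ⦃ _ : NonZero D ⦄ ⦃ _ : NonZero L ⦄ (z : Fin n) (cs : Centres G D L) →
               (∀ j → j < D → length (cs j) ≤ L) → (∀ u → Served G D L cs u) → Burns G (suc D * L)
served⇒burns {n} G D L z cs few served = (λ i → centre (Fin.remQuot {suc D} L i)) , λ u → burnt u (served u)
  where
  centre : Fin (suc D) × Fin L → Fin n
  -- Block `a` of `L` consecutive radii serves class `a ∸ 1`; the vertex `z` fills the places beyond
  -- the end of its list.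
  centre (a , t) = nth z (cs (toℕ a ∸ 1)) (toℕ t)
  burnt : ∀ u → Served G D L cs u → ∃ λ i → Within G u (centre (Fin.remQuot {suc D} L i)) (toℕ i)
  burnt u (j , j<D , c , c∈ , within) with nth-∈ z c∈
  ... | t , t< , refl = Fin.combine a b , subst (λ v → Within G u v (toℕ (Fin.combine a b))) (sym located)
        (within-mono G radius≤ within)
    where
    a : Fin (suc D)
    a = Fin.fromℕ< (s≤s j<D)
    t<L : t < L
    t<L = <-≤-trans t< (few j j<D)
    b : Fin L
    b = Fin.fromℕ< t<L
    located : centre (Fin.remQuot {suc D} L (Fin.combine a b)) ≡ nth z (cs j) t
    located = trans (cong centre (Fin.remQuot-combine a b))
      (cong₂ (λ i s → nth z (cs (i ∸ 1)) s) (Fin.toℕ-fromℕ< (s≤s j<D)) (Fin.toℕ-fromℕ< t<L))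
    radius≤ : suc j * L ≤ toℕ (Fin.combine a b)
    radius≤ = begin
      suc j * L                  ≡⟨ *-comm (suc j) L ⟩
      L * suc j                  ≡⟨ cong (L *_) (Fin.toℕ-fromℕ< (s≤s j<D)) ⟨
      L * toℕ a                  ≤⟨ m≤m+n _ (toℕ b) ⟩
      L * toℕ a + toℕ b          ≡⟨ Fin.toℕ-combine a b ⟨
      toℕ (Fin.combine a b)      ∎
      where open ≤-Reasoning

-- Numerical estimates for the parameters

module _ (e g : ℕ) (D L : ℕ) ⦃ _ : NonZero D ⦄ ⦃ _ : NonZero L ⦄ (D≡ : D ≡ 4 + e) (L≡ : L ≡ 4 * (D * D * D) * g) where

  private
    Z = D * D * L

  -- The choice of `L` makes the allowed excess 4 D² Z g equal to Z L / D, and the pieces add about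
  -- 3 n / D to the cost. Up to the lower term 3 Z, the claim becomes (D + 3) e² + D² ≤ D³, for
  -- which D = e + 4 leaves enough room.
  budget-fits : ∀ n N S → n ≤ e * L * (e * L) → N * Z ≤ n + Z → S ≤ n + N * (1 + 2 * (D * L)) →
                S + 4 * (D * D) * (Z * g) ≤ Z * L
  budget-fits n N S n≤ N≤ S≤ = *-cancelˡ-≤ D (begin
    D * (S + 4 * (D * D) * (Z * g))                              ≡⟨ lem₁ D L S g ⟩
    D * S + Z * (4 * (D * D * D) * g)                            ≡⟨ cong (λ i → D * S + Z * i) L≡ ⟨
    D * S + Z * L                                                ≤⟨ +-monoˡ-≤ (Z * L) (*-monoʳ-≤ D (≤-trans S≤
                                                                      (+-monoʳ-≤ n (*-monoʳ-≤ N (+-monoˡ-≤ _ (1≤DL)))))) ⟩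
    D * (n + N * (D * L + 2 * (D * L))) + Z * L                  ≡⟨ lem₂ D L N n ⟩
    D * n + 3 * (N * Z) + Z * L                                  ≤⟨ +-monoˡ-≤ (Z * L) (+-monoʳ-≤ (D * n) (*-monoʳ-≤ 3 N≤)) ⟩
    D * n + 3 * (n + Z) + Z * L                                  ≡⟨ lem₃ D Z L n ⟩
    (D + 3) * n + (3 * Z + Z * L)                                ≤⟨ +-monoˡ-≤ _ (*-monoʳ-≤ (D + 3) n≤) ⟩
    (D + 3) * (e * L * (e * L)) + (3 * Z + Z * L)                ≤⟨ polynomial ⟩
    D * (Z * L)                                                  ∎)
    where
    open ≤-Reasoning
    1≤DL : 1 ≤ D * L
    1≤DL = *-mono-≤ (>-nonZero⁻¹ D) (>-nonZero⁻¹ L)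
    lem₁ : ∀ D L S g → D * (S + 4 * (D * D) * (D * D * L * g)) ≡ D * S + D * D * L * (4 * (D * D * D) * g)
    lem₁ = solve-∀
    lem₂ : ∀ D L N n → D * (n + N * (D * L + 2 * (D * L))) + D * D * L * L ≡ D * n + 3 * (N * (D * D * L)) + D * D * L * L
    lem₂ = solve-∀
    lem₃ : ∀ D Z L n → D * n + 3 * (n + Z) + Z * L ≡ (D + 3) * n + (3 * Z + Z * L)
    lem₃ = solve-∀
    identity : ∀ e l → (4 + e + 3) * (e * (1 + l) * (e * (1 + l))) +
      (3 * ((4 + e) * (4 + e) * (1 + l)) + (4 + e) * (4 + e) * (1 + l) * (1 + l)) +
      (1 + l) * (e * e + 16 * e + l * (4 * (e * e) + 40 * e + 48)) ≡
      (4 + e) * ((4 + e) * (4 + e) * (1 + l) * (1 + l))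
    identity = solve-∀
    polynomial′ : ∀ l D L → D ≡ 4 + e → L ≡ suc l →
      (D + 3) * (e * L * (e * L)) + (3 * (D * D * L) + D * D * L * L) ≤ D * (D * D * L * L)
    polynomial′ l _ _ refl refl = ≤-trans (m≤m+n _ _) (≤-reflexive (identity e l))
    polynomial : (D + 3) * (e * L * (e * L)) + (3 * Z + Z * L) ≤ D * (Z * L)
    polynomial = polynomial′ (L ∸ 1) D L D≡ (sym (m+[n∸m]≡n (>-nonZero⁻¹ L)))

  -- Each summand takes half of the square. The factor 4 D³ in `L` fits the first one exactly at S =
  -- Z L; for the second, there are at most D L / 2 pieces and `g` absorbs 4 D (K² + 1).
  potential-fits : ∀ N S K → S ≤ Z * L → N * (2 * (D * L)) ≤ S → 4 * D * (K * K + 1) ≤ g →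
    2 * D * (Z * g) * S + N * (D * (4 * Z * K * (4 * Z * K) + 4 * Z * (4 * Z))) ≤
    4 * (D * D) * (Z * g) * (4 * (D * D) * (Z * g))
  potential-fits N S K S≤ N≤S K≤g = begin
    2 * D * (Z * g) * S + N * (D * (4 * Z * K * (4 * Z * K) + 4 * Z * (4 * Z)))
      ≡⟨ cong (2 * D * (Z * g) * S +_) (lem₁ N D Z K) ⟩
    2 * D * (Z * g) * S + N * 2 * (8 * Z * Z * D * (K * K + 1))
      ≤⟨ +-mono-≤ (*-monoʳ-≤ (2 * D * (Z * g)) S≤) (*-monoˡ-≤ (8 * Z * Z * D * (K * K + 1)) 2N≤) ⟩
    2 * D * (Z * g) * (Z * L) + D * L * (8 * Z * Z * D * (K * K + 1))
      ≡⟨ cong (λ i → 2 * D * (Z * g) * (Z * i) + D * i * (8 * Z * Z * D * (K * K + 1))) L≡ ⟩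
    2 * D * (Z * g) * (Z * (4 * (D * D * D) * g)) + D * (4 * (D * D * D) * g) * (8 * Z * Z * D * (K * K + 1))
      ≡⟨ lem₂ D Z g (K * K + 1) ⟩
    8 * (D * D * D * D) * (Z * Z * g) * g + 8 * (D * D * D * D) * (Z * Z * g) * (4 * D * (K * K + 1))
      ≤⟨ +-monoʳ-≤ (8 * (D * D * D * D) * (Z * Z * g) * g) (*-monoʳ-≤ (8 * (D * D * D * D) * (Z * Z * g)) K≤g) ⟩
    8 * (D * D * D * D) * (Z * Z * g) * g + 8 * (D * D * D * D) * (Z * Z * g) * g
      ≡⟨ lem₃ D Z g ⟩
    4 * (D * D) * (Z * g) * (4 * (D * D) * (Z * g)) ∎
    where
    open ≤-Reasoning
    instance
      DL≢0 : NonZero (D * L)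
      DL≢0 = m*n≢0 D L
    assoc : ∀ N D L → N * 2 * (D * L) ≡ N * (2 * (D * L))
    assoc = solve-∀
    2N≤ : N * 2 ≤ D * L
    2N≤ = *-cancelʳ-≤ _ _ (D * L) (≤-trans (≤-reflexive (assoc N D L)) (≤-trans N≤S (≤-trans S≤ (≤-reflexive (square D L)))))
      where
      square : ∀ D L → D * D * L * L ≡ D * L * (D * L)
      square = solve-∀
    lem₁ : ∀ N D Z K → N * (D * (4 * Z * K * (4 * Z * K) + 4 * Z * (4 * Z))) ≡ N * 2 * (8 * Z * Z * D * (K * K + 1))
    lem₁ = solve-∀
    lem₂ : ∀ D Z g M → 2 * D * (Z * g) * (Z * (4 * (D * D * D) * g)) + D * (4 * (D * D * D) * g) * (8 * Z * Z * D * M) ≡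
           8 * (D * D * D * D) * (Z * Z * g) * g + 8 * (D * D * D * D) * (Z * Z * g) * (4 * D * M)
    lem₂ = solve-∀
    lem₃ : ∀ D Z g → 8 * (D * D * D * D) * (Z * Z * g) * g + 8 * (D * D * D * D) * (Z * Z * g) * g ≡
           4 * (D * D) * (Z * g) * (4 * (D * D) * (Z * g))
    lem₃ = solve-∀

-- Burning a connected graph at fixed parameters

module _ {n : ℕ} (G : Graph n) (D L : ℕ) ⦃ _ : NonZero D ⦄ ⦃ _ : NonZero L ⦄ where

  private
    Z = D * D * L

    1≤D : 1 ≤ D
    1≤D = >-nonZero⁻¹ D

    1≤Z : 1 ≤ Z
    1≤Z = *-mono-≤ (*-mono-≤ 1≤D 1≤D) (>-nonZero⁻¹ L)

    DL≤Z : D * L ≤ Z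
    DL≤Z = *-monoˡ-≤ L (≤-trans (≤-reflexive (sym (*-identityʳ D))) (*-monoʳ-≤ D 1≤D))

  cost≤4Z : ∀ {v} (H : Tree G v) → size H < 2 * Z → cost G D L (v , H) ≤ 4 * Z
  cost≤4Z H H< = begin
    suc (size H + 0) + 2 * (D * L)      ≡⟨ cong (λ i → suc i + 2 * (D * L)) (+-identityʳ (size H)) ⟩
    suc (size H) + 2 * (D * L)          ≤⟨ +-mono-≤ H< (*-monoʳ-≤ 2 DL≤Z) ⟩
    2 * Z + 2 * Z                       ≡⟨ *-distribʳ-+ Z 2 2 ⟨
    4 * Z                               ∎
    where open ≤-Reasoning

  total-cost : (ps : List (Piece G)) →
               ∑ ps (cost G D L) ≡ ∑ ps (λ (_ , H) → size H) + length ps * (1 + 2 * (D * L))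
  total-cost ps = trans (∑-cong ps (λ (_ , H) → lem (size H) (2 * (D * L))))
    (trans (∑-+ ps _ _) (cong (∑ ps (λ (_ , H) → size H) +_) (∑-const ps (1 + 2 * (D * L)))))
    where
    lem : ∀ h x → 1 + (h + 0) + x ≡ h + (1 + x)
    lem = solve-∀

  burns : Connected G → Fin n → ∀ e g ⦃ _ : NonZero g ⦄ → D ≡ 4 + e → L ≡ 4 * (D * D * D) * g →
    n ≤ e * L * (e * L) → 4 * D * (D * suc (4 * (D * D)) * (D * suc (4 * (D * D))) + 1) ≤ g → Burns G (suc D * L)
  burns conn z e g D≡ L≡ n≤ K≤g with spanning-tree G conn z
  ... | F , F≤n , spans with cut-tree G Z 1≤Z F
  -- The base price is Z g and q = 4 D², so that q times the base price is the allowed excess `A`; a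
  -- piece costs at most 4 Z by `cost≤4Z`.
  ... | ps , few , total , small , located = from (distribute G D L (Z * g) (4 * (D * D)) (4 * Z) ps
          (All.map (λ {(_ , H)} H< → cost≤4Z H H<) small) budget)
    where
    open ≤-Reasoning
    instance
      Z≢0 : NonZero Z
      Z≢0 = >-nonZero 1≤Z
      Zg≢0 : NonZero (Z * g)
      Zg≢0 = m*n≢0 Z g
    S N A : ℕ
    S = ∑ ps (cost G D L)
    N = length ps
    A = 4 * (D * D) * (Z * g)
    S≤ : S ≤ n + N * (1 + 2 * (D * L))
    S≤ = ≤-trans (≤-reflexive (total-cost ps)) (+-monoˡ-≤ (N * (1 + 2 * (D * L))) (≤-trans (≤-reflexive total) F≤n))
    fits : S + A ≤ Z * L
    fits = budget-fits e g D L D≡ L≡ n N S n≤ (≤-trans few (+-monoˡ-≤ Z F≤n)) S≤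
    N≤S : N * (2 * (D * L)) ≤ S
    N≤S = ≤-trans (*-monoʳ-≤ N (n≤1+n (2 * (D * L)))) (≤-trans (m≤n+m _ (∑ ps (λ (_ , H) → size H)))
            (≤-reflexive (sym (total-cost ps))))
    budget : Within-budget G D L (Z * g) (4 * (D * D)) (4 * Z) ps
    budget = potential-fits e g D L D≡ L≡ N S (D * suc (4 * (D * D))) (m+n≤o⇒m≤o S fits) N≤S K≤g
    from : (∃ λ (cs : Centres G D L) → (∀ u → Any.Any (λ (_ , H) → Has G H u) ps → Served G D L cs u) ×
             potential G D L cs S ≤ 2 * D * (Z * g) * S + N * drift G D L (Z * g) (4 * (D * D)) (4 * Z)) →
           Burns G (suc D * L)
    from (cs , served , pot≤) = served⇒burns G D L z cs few-centres (λ u → served u (located u (spans u)))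
      where
      few-centres : ∀ j → j < D → length (cs j) ≤ L
      few-centres j j<D = *-cancelˡ-≤ Z (begin
        Z * length (cs j)                                   ≤⟨ m≤n+m∸n (Z * length (cs j)) S ⟩
        S + excess G D L cs S j                             ≤⟨ +-monoʳ-≤ S (square-cancel-≤ (≤-trans
                                                                 (∑-term (λ j → excess G D L cs S j * excess G D L cs S j) (∈-downFrom⁺ j<D))
                                                                 (≤-trans pot≤ budget))) ⟩
        S + A                                               ≤⟨ fits ⟩
        Z * L                                               ∎)

-- Choosing the parameters for given k and n

-- Traps a square root between consecutive multiples of `m`. Counting `t` up from the square of
-- `m * g₀` yields `g₀ ≤ g` along the way.
bracket : (m : ℕ) ⦃ _ : NonZero m ⦄ (g₀ t : ℕ) → ∃ λ g → g₀ ≤ g ×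
          m * g * (m * g) ≤ m * g₀ * (m * g₀) + t × m * g₀ * (m * g₀) + t ≤ m * suc g * (m * suc g)
bracket m g₀ zero = g₀ , ≤-refl , m≤m+n _ 0 , ≤-trans (≤-reflexive (+-identityʳ _))
  (*-mono-≤ (*-monoʳ-≤ m (n≤1+n g₀)) (*-monoʳ-≤ m (n≤1+n g₀)))
bracket m g₀ (suc t) with bracket m g₀ t
... | g , g₀≤g , lo , hi with m≤n⇒m<n∨m≡n hi
...   | inj₁ N<hi = g , g₀≤g , ≤-trans lo (+-monoʳ-≤ (m * g₀ * (m * g₀)) (n≤1+n t)) ,
                    ≤-trans (≤-reflexive (+-suc (m * g₀ * (m * g₀)) t)) N<hi
...   | inj₂ N≡hi = suc g , m≤n⇒m≤1+n g₀≤g ,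
                    ≤-trans (≤-reflexive (sym N≡hi)) (+-monoʳ-≤ (m * g₀ * (m * g₀)) (n≤1+n t)) ,
                    ≤-trans (≤-reflexive (trans (+-suc (m * g₀ * (m * g₀)) t) (cong suc N≡hi)))
                      (*-mono-< (*-monoʳ-< m (n<1+n (suc g))) (*-monoʳ-< m (n<1+n (suc g))))

-- With c = 4 D³, the bracket uses m = 6 k c and the burning sequence has length b = (6 k + 5) c (g + 1).
ratio-bound : ∀ k c g n → 6 * k + 5 ≤ g → 6 * k * c * g * (6 * k * c * g) ≤ n →
              ∀ D → D ≡ 4 + 6 * k → (suc D * (c * suc g) * k) ^ 2 ≤ (k + 1) ^ 2 * n
ratio-bound k c g n large lo _ refl = begin
  (suc (4 + 6 * k) * (c * suc g) * k) ^ 2                      ≤⟨ ^-monoˡ-≤ 2 (≤-from (*-monoʳ-≤ (c * k) large) 0 (lem k c g)) ⟩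
  ((k + 1) * (6 * k * c * g)) ^ 2                              ≡⟨ square (k + 1) (6 * k * c * g) ⟩
  (k + 1) ^ 2 * (6 * k * c * g * (6 * k * c * g))              ≤⟨ *-monoʳ-≤ ((k + 1) ^ 2) lo ⟩
  (k + 1) ^ 2 * n                                              ∎
  where
  open ≤-Reasoning
  lem : ∀ k c g → (1 + (4 + 6 * k)) * (c * (1 + g)) * k + c * k * g + 0 ≡ c * k * (6 * k + 5) + (k + 1) * (6 * k * c * g)
  lem = solve-∀
  square : ∀ a b → a * b * (a * b * 1) ≡ a * (a * 1) * (b * b)
  square = solve-∀

-- With e = 6 k, the ratio (D + 1) / e = (6 k + 5) / (6 k) is below (k + 1) / k by 1 / (6 k). This
-- gap absorbs the step from g to g + 1 once g ≥ 6 k + 5; the other summand of `g₀` is what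
-- `potential-fits` demands.
sqrt-bound : ∀ k D ⦃ _ : NonZero k ⦄ ⦃ _ : NonZero D ⦄ → D ≡ 4 + 6 * k →
             ∃ λ N → ∀ n → N ≤ n → (G : Graph n) → Connected G → BurningNumberAtMostSqrt G k
-- The `suc` guarantees a vertex, which serves as the root of the spanning tree.
sqrt-bound k D ⦃ _ ⦄ ⦃ D≢0 ⦄ D≡ = suc (m * g₀ * (m * g₀)) ,
  λ n N≤n G conn → from n G conn (m+[n∸m]≡n (<⇒≤ N≤n)) (≤-trans (s≤s z≤n) N≤n)
  where
  c K m g₀ : ℕ
  c = 4 * (D * D * D)
  K = D * suc (4 * (D * D))
  m = 6 * k * c
  g₀ = 6 * k + 5 + 4 * D * (K * K + 1)
  instance
    6k≢0 : NonZero (6 * k)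
    6k≢0 = m*n≢0 6 k
    D³≢0 : NonZero (D * D * D)
    D³≢0 = m*n≢0 (D * D) D ⦃ m*n≢0 D D ⦄
    c≢0 : NonZero c
    c≢0 = m*n≢0 4 (D * D * D)
    m≢0 : NonZero m
    m≢0 = m*n≢0 (6 * k) c
  from : ∀ n (G : Graph n) → Connected G → m * g₀ * (m * g₀) + (n ∸ m * g₀ * (m * g₀)) ≡ n → 1 ≤ n →
         BurningNumberAtMostSqrt G k
  from n@(suc _) G conn n≡ _ with bracket m g₀ (n ∸ m * g₀ * (m * g₀))
  ... | g , g₀≤g , lo , hi = suc D * (c * suc g) ,
    burns G D (c * suc g) ⦃ D≢0 ⦄ ⦃ m*n≢0 c (suc g) ⦄ conn Fin.zero (6 * k) (suc g) D≡ refl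
      (subst₂ _≤_ n≡ (cong (λ i → i * i) (*-assoc (6 * k) c (suc g))) hi)
      (m≤n⇒m≤1+n (≤-trans (m≤n+m _ (6 * k + 5)) g₀≤g)) ,
    ratio-bound k c g n (≤-trans (m≤m+n _ _) g₀≤g) (subst (m * g * (m * g) ≤_) n≡ lo) D D≡

theorem1p2 : ∀ (k : ℕ) → 1 ≤ k → ∃ λ (N : ℕ) → ∀ (n : ℕ) → N ≤ n → (G : Graph n) → Connected G → BurningNumberAtMostSqrt G k
theorem1p2 k 1≤k = sqrt-bound k (4 + 6 * k) ⦃ >-nonZero 1≤k ⦄ refl
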